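{- Let $D\ge2$ be squarefree and $K=\mathbb{Q}(\sqrt D)$ with discriminant $\Delta$. If $\alpha\in\mathcal{O}_K^+$ is uniquely decomposable, then \[N(\alpha)<\sqrt\Delta\bigl(2\sqrt\Delta+1\bigr)\bigl(3\sqrt\Delta+2\bigr).\]
   Context: $\mathcal{O}_K$ is the ring of integers of $K$, $\alpha'$ the Galois conjugate of $\alpha$, $N(\alpha)=\alpha\alpha'$. $\Delta=4D$ if $D\equiv2,3\pmod4$ and $\Delta=D$ if $D\equiv1\pmod4$. $\mathcal{O}_K^+$ is the set of $\alpha\in\mathcal{O}_K$ with $\alpha>0$ and $\alpha'>0$; $\alpha\in\mathcal{O}_K^+$ is indecomposable if it cannot be written as a sum of two elements of $\mathcal{O}_K^+$, and uniquely decomposable if there is exactly one way (up to order of summands) to write it as a sum of indecomposable elements. -}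

module Defs where

open import Data.Nat as ℕ using (ℕ; _%_)
open import Data.Nat.Divisibility using (_∣_)
open import Data.Integer as ℤ using (ℤ; +_; 0ℤ; _+_; _*_; _-_; -_; _<_; _≤_)
open import Data.Product using (_×_; _,_; ∃; ∃-syntax; Σ)
open import Data.Sum using (_⊎_)
open import Data.List using (List; foldr)
open import Data.List.Relation.Unary.All using (All)
open import Data.List.Relation.Binary.Permutation.Propositional using (_↭_)
open import Relation.Binary.PropositionalEquality using (_≡_)
open import Relation.Nullary using (¬_; yes; no; Dec)

SquareFree : ℕ → Set
SquareFree D = ∀ n → n ℕ.* n ∣ D → n ≡ 1

D≡1mod4? : (D : ℕ) → Dec (D % 4 ≡ 1)
D≡1mod4? D = D % 4 ℕ.≟ 1

disc : ℕ → ℕ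
disc D with D≡1mod4? D
... | yes _ = D
... | no  _ = 4 ℕ.* D

-- Elements of ℤ[√m], a pair (x , y) standing for the real number x + y√m.
ZS : Set
ZS = ℤ × ℤ

_⊕_ : ZS → ZS → ZS
(a , b) ⊕ (c , d) = (a + c , b + d)

_⊖_ : ZS → ZS → ZS
(a , b) ⊖ (c , d) = (a - c , b - d)

mulS : ℕ → ZS → ZS → ZS
mulS m (a , b) (c , d) = (a * c + + m * (b * d) , a * d + b * c)

-- x + y√m > 0 as a real number (m ≥ 0), expressed in integer arithmetic
Pos : ℕ → ZS → Set
Pos m (x , y) =
    (0ℤ < x × 0ℤ ≤ y)
  ⊎ (0ℤ ≤ x × 0ℤ < y)
  ⊎ (0ℤ < x × y < 0ℤ × + m * (y * y) < x * x)
  ⊎ (x < 0ℤ × 0ℤ < y × x * x < + m * (y * y))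

-- Elements of O_K, written in the integral basis {1, ω}:
-- (x , y) ↦ x + yω, with ω = √D if D ≢ 1 (mod 4), ω = (1+√D)/2 if D ≡ 1 (mod 4).
OK : Set
OK = ℤ × ℤ

zeroK : OK
zeroK = (0ℤ , 0ℤ)

_+K_ : OK → OK → OK
(a , b) +K (c , d) = (a + c , b + d)

sumK : List OK → OK
sumK = foldr _+K_ zeroK

-- the real number 2α, written in ℤ[√D]
twice : ℕ → OK → ZS
twice D (x , y) with D≡1mod4? D
... | yes _ = (+ 2 * x + y , y)
... | no  _ = (+ 2 * x , + 2 * y)

twiceConj : ℕ → OK → ZS
twiceConj D α with twice D α
... | (a , b) = (a , - b)

TotPos : ℕ → OK → Set
TotPos D α = Pos D (twice D α) × Pos D (twiceConj D α)

normK : ℕ → OK → ℤ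
normK D (x , y) with D≡1mod4? D
... | yes _ = x * x + x * y - + (D ℕ./ 4) * (y * y)   -- (D-1)/4 = ⌊D/4⌋
... | no  _ = x * x - + D * (y * y)

Indecomposable : ℕ → OK → Set
Indecomposable D α =
  TotPos D α × ¬ (Σ OK λ β → Σ OK λ γ → TotPos D β × TotPos D γ × α ≡ β +K γ)

IsDecomposition : ℕ → OK → List OK → Set
IsDecomposition D α l = All (Indecomposable D) l × sumK l ≡ α

UniquelyDecomposable : ℕ → OK → Set
UniquelyDecomposable D α =
  TotPos D α ×
  Σ (List OK) λ l → IsDecomposition D α l ×
    (∀ l' → IsDecomposition D α l' → l' ↭ l)

bound : ℕ → ZS
bound Δ = mulS Δ (mulS Δ s (mulS Δ (+ 2 , 0ℤ) s ⊕ (+ 1 , 0ℤ)))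
                 (mulS Δ (+ 3 , 0ℤ) s ⊕ (+ 2 , 0ℤ))
  where s : ZS
        s = (0ℤ , + 1)

_<ₛ_ : ℤ → ℕ × ZS → Set
n <ₛ (Δ , q) = Pos Δ (q ⊖ (n , 0ℤ))

{-# OPTIONS --safe #-}
module Submission where

-- Let b = N(β) for an indecomposable β, complete β to a basis (β, τ) and let t = Tr(βτ′), so that
-- t² = 4bN(τ) + Δ. Adding multiples of β to τ moves t into any window of length 2b. With 0 ≤ t < 2b,
-- the indecomposability of β = τ + (β - τ) forces 4b ≤ Δ. With ⌊√Δ⌋ < t ≤ ⌊√Δ⌋ + 2b, both τ and nβ - τ
-- are totally positive as soon as (n - 1)b > ⌊√Δ⌋, so that nβ is not uniquely decomposable.
-- Two distinct indecomposables β, γ in the decomposition of a uniquely decomposable α have determinant ±1,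
-- since otherwise their parallelogram contains a further lattice point, which decomposes β + γ in
-- another way; hence there cannot be three of them. So α = eβ + fγ with e, f controlled by N(β), N(γ),
-- and with s = ⌊√Δ⌋ the expansion of the norm gives N(α) ≤ (s+1)²(s+4) < 7Δ + s(6Δ+2).

open import Defs
open import Data.Nat as ℕ using (ℕ)
import Data.Nat.Properties as ℕ
import Data.Nat.Divisibility as ℕ
open import Data.Nat.DivMod using (m≡m%n+[m/n]*n)
open import Data.Nat.GCD using (module GCD; module Bézout)
open import Data.Nat.Primality using (prime[2]; euclidsLemma)
open import Data.Nat.Tactic.RingSolver using () renaming (solve-∀ to solveℕ-∀)
open import Data.Integer as ℤ using (ℤ; +_; -[1+_]; +[1+_]; 0ℤ; 1ℤ; -1ℤ; _+_; _*_; _-_; -_; _<_; _≤_; +<+; +≤+; ∣_∣)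
open import Data.Integer.Properties
open import Data.Integer.DivMod using (_%ℕ_; _/ℕ_; a≡a%ℕn+[a/ℕn]*n; n%ℕd<d)
open import Data.Integer.Divisibility.Signed using (_∣_; divides; ∣ᵤ⇒∣; ∣⇒∣ᵤ; ∣-refl; ∣m∣n⇒∣m+n; 0∣⇒≡0)
open import Data.Integer.Tactic.RingSolver using (solve-∀)
open import Data.List using (List; []; _∷_; [_]; _++_; replicate)
open import Data.List.Properties using (++-identityʳ)
open import Data.List.Relation.Unary.All as All using (All; []; _∷_)
import Data.List.Relation.Unary.All.Properties as All
open import Data.List.Relation.Unary.Any using (here; there)
open import Data.List.Membership.Propositional using (_∈_)
open import Data.List.Membership.Propositional.Properties using (∈-∃++; ∈-++⁺ʳ)
open import Data.List.Relation.Binary.Permutation.Propositional using (_↭_; ↭-refl; ↭-sym; ↭-trans; prep; swap)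
open import Data.List.Relation.Binary.Permutation.Propositional.Properties using (All-resp-↭; ∈-resp-↭; drop-∷; shift; ++⁺ˡ; ++-comm)
open import Data.Product using (_×_; _,_; proj₁; proj₂; ∃-syntax; ∃₂)
import Data.Product.Properties as Product
open import Data.Sum using (_⊎_; inj₁; inj₂; [_,_]′; reduce)
open import Relation.Binary.Definitions using (tri<; tri≈; tri>; DecidableEquality)
open import Relation.Binary.PropositionalEquality using (_≡_; _≢_; refl; sym; trans; cong; cong₂; subst; subst₂; module ≡-Reasoning)
open import Relation.Nullary using (¬_; yes; no; contradiction)
open import Relation.Nullary.Decidable using (toSum)

-- Order on the integers

0<* : ∀ {a b} → 0ℤ < a → 0ℤ < b → 0ℤ < a * b
0<* {+[1+ _ ]} {+[1+ _ ]} _ _ = +<+ (ℕ.s≤s ℕ.z≤n)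
0<* {+ 0} (+<+ ()) _
0<* {+[1+ _ ]} {+ 0} _ (+<+ ())

0≤* : ∀ {a b} → 0ℤ ≤ a → 0ℤ ≤ b → 0ℤ ≤ a * b
0≤* {+ m} {+ n} _ _ = subst (0ℤ ≤_) (pos-* m n) (+≤+ ℕ.z≤n)

0≤a² : ∀ a → 0ℤ ≤ a * a
0≤a² (+ n)    = 0≤* {+ n} {+ n} (+≤+ ℕ.z≤n) (+≤+ ℕ.z≤n)
0≤a² -[1+ n ] = +≤+ ℕ.z≤n

≤-by : ∀ {a b c} → 0ℤ ≤ c → b ≡ a + c → a ≤ b
≤-by {a} {c = c} 0≤c refl = subst (_≤ a + c) (+-identityʳ a) (+-monoʳ-≤ a 0≤c)

<-by : ∀ {a b c} → 0ℤ < c → b ≡ a + c → a < b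
<-by {a} {c = c} 0<c refl = subst (_< a + c) (+-identityʳ a) (+-monoʳ-< a 0<c)

0<b-a : ∀ {a b} → a < b → 0ℤ < b - a
0<b-a {a} {b} a<b = subst (_< b - a) (+-inverseʳ a) (+-monoˡ-< (- a) a<b)

0<a*b⇒0<a : ∀ {a b} → 0ℤ ≤ b → 0ℤ < a * b → 0ℤ < a
0<a*b⇒0<a {a} {b} 0≤b 0<ab with <-cmp 0ℤ a
... | tri< 0<a _ _ = 0<a
... | tri≈ _ refl _ = contradiction 0<ab (<-irrefl (sym (*-zeroˡ b)))
... | tri> _ _ a<0 = contradiction (<-≤-trans 0<ab (≤-by (0≤* (<⇒≤ (0<b-a a<0)) 0≤b) (ring a b))) (<-irrefl refl)
  where
  ring : ∀ a b → 0ℤ ≡ a * b + (0ℤ - a) * b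
  ring = solve-∀

*-mono-≤ : ∀ {a b c d} → 0ℤ ≤ a → a ≤ b → 0ℤ ≤ c → c ≤ d → a * c ≤ b * d
*-mono-≤ {a} {b} {c} {d} 0≤a a≤b 0≤c c≤d = ≤-by
  (+-mono-≤ (0≤* 0≤a (i≤j⇒0≤j-i c≤d)) (0≤* (i≤j⇒0≤j-i a≤b) (≤-trans 0≤c c≤d))) (ring a b c d)
  where
  ring : ∀ a b c d → b * d ≡ a * c + (a * (d - c) + (b - a) * d)
  ring = solve-∀

square-cancel-≤ : ∀ {a b} → 0ℤ ≤ b → a * a ≤ b * b → a ≤ b
square-cancel-≤ {a} {b} 0≤b a²≤b² = ≮⇒≥ λ b<a → <⇒≱
  (<-by (+-mono-≤-< (0≤* 0≤b (<⇒≤ (0<b-a b<a))) (0<* (0<b-a b<a) (≤-<-trans 0≤b b<a))) (ring a b)) a²≤b²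
  where
  ring : ∀ a b → a * a ≡ b * b + (b * (a - b) + (a - b) * a)
  ring = solve-∀

infixr 21 _·_

_·_ : ℤ → OK → OK
n · (x , y) = (n * x , n * y)

-- Binary quadratic forms of norm type

opaque

  -- The signed area of (α, β), which is (α′β − αβ′)/√Δ.
  det : OK → OK → ℤ
  det (x , y) (z , w) = x * w - z * y

  det-+ : ∀ α β γ → det α (β +K γ) ≡ det α β + det α γ
  det-+ (x , y) (z , w) (u , v) = ring x y z w u v
    where
    ring : ∀ x y z w u v → x * (w + v) - (z + u) * y ≡ (x * w - z * y) + (x * v - u * y)
    ring = solve-∀

  det-· : ∀ n α β → det α (n · β) ≡ n * det α β
  det-· n (x , y) (z , w) = ring n x y z w
    where
    ring : ∀ n x y z w → x * (n * w) - (n * z) * y ≡ n * (x * w - z * y)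
    ring = solve-∀

  det-self : ∀ α → det α α ≡ 0ℤ
  det-self (x , y) = +-inverseʳ (x * y)

  det-swap : ∀ α β → det β α ≡ - det α β
  det-swap (x , y) (z , w) = ring x y z w
    where
    ring : ∀ x y z w → z * y - x * w ≡ - (x * w - z * y)
    ring = solve-∀

  det-≡ : ∀ x y z w → det (x , y) (z , w) ≡ x * w - z * y
  det-≡ x y z w = refl

  -- Three vectors of a rank 2 lattice satisfy a linear relation whose coefficients are their 2 by 2
  -- minors. Free of division, it needs no assumption on `det α β`.
  cramer : ∀ α β γ → det α β · γ ≡ det γ β · α +K det α γ · β
  cramer (x , y) (z , w) (u , v) = cong₂ _,_ (ring₁ x y z w u v) (ring₂ x y z w u v)
    where
    ring₁ : ∀ x y z w u v → (x * w - z * y) * u ≡ (u * w - z * v) * x + (x * v - u * y) * z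
    ring₁ = solve-∀
    ring₂ : ∀ x y z w u v → (x * w - z * y) * v ≡ (u * w - z * v) * y + (x * v - u * y) * w
    ring₂ = solve-∀

-- The order ℤ[ω] with ω² = εω + k.
module Form (ε k : ℤ) where

  Δ : ℤ
  Δ = ε * ε + + 4 * k

  opaque
    unfolding det

    Tr : OK → ℤ
    Tr (x , y) = + 2 * x + ε * y

    N : OK → ℤ
    N (x , y) = x * x + ε * (x * y) - k * (y * y)

    -- The trace of αβ′.
    ⟨_,_⟩ : OK → OK → ℤ
    ⟨ (x , y) , (z , w) ⟩ = + 2 * (x * z) + ε * (x * w + z * y) - + 2 * (k * (y * w))

    Tr-≡ : ∀ x y → Tr (x , y) ≡ + 2 * x + ε * y
    Tr-≡ x y = refl

    N-≡ : ∀ x y → N (x , y) ≡ x * x + ε * (x * y) - k * (y * y)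
    N-≡ x y = refl

    Tr-+ : ∀ α β → Tr (α +K β) ≡ Tr α + Tr β
    Tr-+ (x , y) (z , w) = ring ε x y z w
      where
      ring : ∀ ε x y z w → + 2 * (x + z) + ε * (y + w) ≡ (+ 2 * x + ε * y) + (+ 2 * z + ε * w)
      ring = solve-∀

    Tr-· : ∀ n α → Tr (n · α) ≡ n * Tr α
    Tr-· n (x , y) = ring ε n x y
      where
      ring : ∀ ε n x y → + 2 * (n * x) + ε * (n * y) ≡ n * (+ 2 * x + ε * y)
      ring = solve-∀

    N-+ : ∀ α β → N (α +K β) ≡ N α + N β + ⟨ α , β ⟩
    N-+ (x , y) (z , w) = ring ε k x y z w
      where
      ring : ∀ ε k x y z w → let N = λ x y → x * x + ε * (x * y) - k * (y * y) in
        N (x + z) (y + w) ≡ N x y + N z w + (+ 2 * (x * z) + ε * (x * w + z * y) - + 2 * (k * (y * w)))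
      ring = solve-∀

    N-· : ∀ n α → N (n · α) ≡ n * n * N α
    N-· n (x , y) = ring ε k n x y
      where
      ring : ∀ ε k n x y → let N = λ x y → x * x + ε * (x * y) - k * (y * y) in
        N (n * x) (n * y) ≡ n * n * N x y
      ring = solve-∀

    ⟨⟩-+ : ∀ α β γ → ⟨ α , β +K γ ⟩ ≡ ⟨ α , β ⟩ + ⟨ α , γ ⟩
    ⟨⟩-+ (x , y) (z , w) (u , v) = ring ε k x y z w u v
      where
      ring : ∀ ε k x y z w u v →
        let B = λ z w → + 2 * (x * z) + ε * (x * w + z * y) - + 2 * (k * (y * w)) in
        B (z + u) (w + v) ≡ B z w + B u v
      ring = solve-∀

    ⟨⟩-· : ∀ n α β → ⟨ α , n · β ⟩ ≡ n * ⟨ α , β ⟩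
    ⟨⟩-· n (x , y) (z , w) = ring ε k n x y z w
      where
      ring : ∀ ε k n x y z w →
        let B = λ z w → + 2 * (x * z) + ε * (x * w + z * y) - + 2 * (k * (y * w)) in
        B (n * z) (n * w) ≡ n * B z w
      ring = solve-∀

    ⟨⟩-comm : ∀ α β → ⟨ α , β ⟩ ≡ ⟨ β , α ⟩
    ⟨⟩-comm (x , y) (z , w) = ring ε k x y z w
      where
      ring : ∀ ε k x y z w → let B = λ x y z w → + 2 * (x * z) + ε * (x * w + z * y) - + 2 * (k * (y * w)) in
        B x y z w ≡ B z w x y
      ring = solve-∀

    ⟨⟩-self : ∀ α → ⟨ α , α ⟩ ≡ + 2 * N α
    ⟨⟩-self (x , y) = ring ε k x y
      where
      ring : ∀ ε k x y → + 2 * (x * x) + ε * (x * y + x * y) - + 2 * (k * (y * y)) ≡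
        + 2 * (x * x + ε * (x * y) - k * (y * y))
      ring = solve-∀

    -- The Gram matrix of the trace form on 1, ω has determinant -Δ, and passing to α, β multiplies
    -- it by `det α β` squared. For a basis the last term is just Δ.
    gram : ∀ α β → ⟨ α , β ⟩ * ⟨ α , β ⟩ ≡ + 4 * (N α * N β) + Δ * (det α β * det α β)
    gram (x , y) (z , w) = ring ε k x y z w
      where
      ring : ∀ ε k x y z w →
        let N = λ x y → x * x + ε * (x * y) - k * (y * y)
            B = + 2 * (x * z) + ε * (x * w + z * y) - + 2 * (k * (y * w))
            d = x * w - z * y
        in B * B ≡ + 4 * (N x y * N z w) + (ε * ε + + 4 * k) * (d * d)
      ring = solve-∀

    -- The vanishing of the Gram determinant of 1, α, β.
    gram₁ : ∀ α β → Tr α * (Tr β * ⟨ α , β ⟩) ≡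
      N β * (Tr α * Tr α) + N α * (Tr β * Tr β) + Δ * (det α β * det α β)
    gram₁ (x , y) (z , w) = ring ε k x y z w
      where
      ring : ∀ ε k x y z w →
        let N = λ x y → x * x + ε * (x * y) - k * (y * y)
            T = λ x y → + 2 * x + ε * y
            B = + 2 * (x * z) + ε * (x * w + z * y) - + 2 * (k * (y * w))
            d = x * w - z * y
        in T x y * (T z w * B) ≡
           N z w * (T x y * T x y) + N x y * (T z w * T z w) + (ε * ε + + 4 * k) * (d * d)
      ring = solve-∀

    -- The case β = 1 of `gram`, since ⟨α, 1⟩ = Tr α and det(α, 1) = -y.
    discriminant : ∀ α → Tr α * Tr α ≡ Δ * (proj₂ α * proj₂ α) + + 4 * N α
    discriminant (x , y) = ring ε k x y
      where
      ring : ∀ ε k x y → (+ 2 * x + ε * y) * (+ 2 * x + ε * y) ≡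
        (ε * ε + + 4 * k) * (y * y) + + 4 * (x * x + ε * (x * y) - k * (y * y))
      ring = solve-∀

  -- Total positivity without square roots: α and α′ are both positive exactly when their product
  -- and their sum are.
  record P (α : OK) : Set where
    constructor _,_
    field
      0<N : 0ℤ < N α
      0<Tr : 0ℤ < Tr α

  open P public

  module Positivity (0<Δ : 0ℤ < Δ) where

    private
      0≤Δd² : ∀ d → 0ℤ ≤ Δ * (d * d)
      0≤Δd² d = 0≤* (<⇒≤ 0<Δ) (0≤a² d)

      0<gram₁ : ∀ {α β} → 0ℤ < N α → P β → 0ℤ < Tr α * (Tr β * ⟨ α , β ⟩)
      0<gram₁ {α} {β} 0<Nα (0<Nβ , 0<Tβ) = subst (0ℤ <_) (sym (gram₁ α β))
        (+-mono-<-≤ (+-mono-≤-< (0≤* (<⇒≤ 0<Nβ) (0≤a² (Tr α))) (0<* 0<Nα (0<* 0<Tβ 0<Tβ))) (0≤Δd² (det α β)))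

    -- By `gram₁` the product of the pairing with the two positive traces is a sum of nonnegative
    -- terms, one of them positive.
    ⟨⟩-pos : ∀ {α β} → P α → P β → 0ℤ < ⟨ α , β ⟩
    ⟨⟩-pos {α} {β} (0<Nα , 0<Tα) pβ@(_ , 0<Tβ) = 0<a*b⇒0<a (<⇒≤ (0<* 0<Tα 0<Tβ))
      (subst (0ℤ <_) (ring (Tr α) (Tr β) ⟨ α , β ⟩) (0<gram₁ {α} {β} 0<Nα pβ))
      where
      ring : ∀ a b c → a * (b * c) ≡ c * (a * b)
      ring = solve-∀

    -- A positive norm gives α and α′ a common sign, and pairing with a totally positive β detects
    -- that sign. This is how elements are shown totally positive once their norm is known to be
    -- positive.
    P-criterion : ∀ {α β} → P β → 0ℤ < N α → 0ℤ ≤ ⟨ β , α ⟩ → P α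
    P-criterion {α} {β} pβ 0<Nα 0≤t = 0<Nα , 0<a*b⇒0<a
      (0≤* (<⇒≤ (0<Tr pβ)) (subst (0ℤ ≤_) (⟨⟩-comm β α) 0≤t)) (0<gram₁ {α} {β} 0<Nα pβ)

    P-+ : ∀ {α β} → P α → P β → P (α +K β)
    P-+ {α} {β} pα pβ =
      subst (0ℤ <_) (sym (N-+ α β)) (+-mono-< (+-mono-< (0<N pα) (0<N pβ)) (⟨⟩-pos pα pβ)) ,
      subst (0ℤ <_) (sym (Tr-+ α β)) (+-mono-< (0<Tr pα) (0<Tr pβ))

    P-· : ∀ n {α} → 0ℤ < n → P α → P (n · α)
    P-· n {α} 0<n (0<N , 0<T) =
      subst (0ℤ <_) (sym (N-· n α)) (0<* (0<* 0<n 0<n) 0<N) ,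
      subst (0ℤ <_) (sym (Tr-· n α)) (0<* 0<n 0<T)

    P-·⁻ : ∀ n {α} → 0ℤ < n → P (n · α) → P α
    P-·⁻ n {α} 0<n (0<N , 0<T) =
      0<a*b⇒0<a (<⇒≤ (0<* 0<n 0<n)) (subst (0ℤ <_) (trans (N-· n α) (*-comm (n * n) (N α))) 0<N) ,
      0<a*b⇒0<a (<⇒≤ 0<n) (subst (0ℤ <_) (trans (Tr-· n α) (*-comm n (Tr α))) 0<T)

-- Lattice bases and lists of lattice points

1·_ : ∀ α → 1ℤ · α ≡ α
1· (x , y) = cong₂ _,_ (*-identityˡ x) (*-identityˡ y)

·-distribʳ : ∀ m n α → (m + n) · α ≡ m · α +K n · α
·-distribʳ m n (x , y) = cong₂ _,_ (*-distribʳ-+ x m n) (*-distribʳ-+ y m n)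

basis-expansion : ∀ {α β} γ → det α β ≡ 1ℤ → γ ≡ det γ β · α +K det α γ · β
basis-expansion {α} {β} γ eq = begin
  γ                                 ≡⟨ 1· γ ⟨
  1ℤ · γ                            ≡⟨ cong (_· γ) eq ⟨
  det α β · γ                       ≡⟨ cramer α β γ ⟩
  det γ β · α +K det α γ · β        ∎
  where open ≡-Reasoning

+K-complement : ∀ α β → α ≡ β +K (α +K -1ℤ · β)
+K-complement (x , y) (z , w) = cong₂ _,_ (ring x z) (ring y w)
  where
  ring : ∀ x z → x ≡ z + (x + -1ℤ * z)
  ring = solve-∀

-- Here `d` is the gcd of the coordinates and α the primitive part. A Bézout relation ux - vy = d is
-- a determinant with the vector (v, u); σ and ρ restore the signs lost in passing to absolute
-- values.
bézout : ∀ x y → ∃[ d ] ∃[ α ] ∃[ τ ] (x , y) ≡ (+ d) · α × + d ≡ det (x , y) τ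
bézout x y with Bézout.lemma ∣ x ∣ ∣ y ∣ | abs-multiple x | abs-multiple y
  where
  abs-multiple : ∀ x → ∃[ σ ] + ∣ x ∣ ≡ σ * x
  abs-multiple (+ n)    = 1ℤ , sym (*-identityˡ (+ n))
  abs-multiple -[1+ n ] = -1ℤ , sym (-1*i≡-i -[1+ n ])
... | Bézout.result d g b | σ , ∣x∣≡ | ρ , ∣y∣≡ = d , (x₀ , y₀) , τ b , cong₂ _,_ x≡ y≡ , det≡ b
  where
  open ≡-Reasoning
  dx : + d ∣ x
  dx = ∣ᵤ⇒∣ (GCD.gcd∣m g)
  dy : + d ∣ y
  dy = ∣ᵤ⇒∣ (GCD.gcd∣n g)
  x₀ y₀ : ℤ
  x₀ = _∣_.quotient dx
  y₀ = _∣_.quotient dy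
  x≡ : x ≡ + d * x₀
  x≡ = trans (_∣_.equality dx) (*-comm x₀ (+ d))
  y≡ : y ≡ + d * y₀
  y≡ = trans (_∣_.equality dy) (*-comm y₀ (+ d))
  τ : Bézout.Identity d ∣ x ∣ ∣ y ∣ → OK
  τ (Bézout.+- u v _) = (+ v * ρ , + u * σ)
  τ (Bézout.-+ u v _) = (- (+ v * ρ) , - (+ u * σ))
  cast : ∀ {a b c e} → d ℕ.+ a ℕ.* b ≡ c ℕ.* e → + d ≡ + c * + e - + a * + b
  cast {a} {b} {c} {e} eq = begin
    + d                                 ≡⟨ ring (+ d) (+ a * + b) ⟩
    (+ d + + a * + b) - + a * + b       ≡⟨ cong (λ t → (+ d + t) - + a * + b) (pos-* a b) ⟨
    + (d ℕ.+ a ℕ.* b) - + a * + b       ≡⟨ cong (λ t → + t - + a * + b) eq ⟩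
    + (c ℕ.* e) - + a * + b             ≡⟨ cong (_- + a * + b) (pos-* c e) ⟩
    + c * + e - + a * + b               ∎
    where
    ring : ∀ p q → p ≡ (p + q) - q
    ring = solve-∀
  det≡ : ∀ b → + d ≡ det (x , y) (τ b)
  det≡ (Bézout.+- u v eq) = begin
    + d                                     ≡⟨ cast {v} {∣ y ∣} {u} {∣ x ∣} eq ⟩
    + u * + ∣ x ∣ - + v * + ∣ y ∣           ≡⟨ cong₂ (λ p q → + u * p - + v * q) ∣x∣≡ ∣y∣≡ ⟩
    + u * (σ * x) - + v * (ρ * y)           ≡⟨ ring (+ u) σ x (+ v) ρ y ⟩
    x * (+ u * σ) - + v * ρ * y             ≡⟨ det-≡ x y (+ v * ρ) (+ u * σ) ⟨
    det (x , y) (+ v * ρ , + u * σ)         ∎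
    where
    ring : ∀ u σ x v ρ y → u * (σ * x) - v * (ρ * y) ≡ x * (u * σ) - v * ρ * y
    ring = solve-∀
  det≡ (Bézout.-+ u v eq) = begin
    + d                                     ≡⟨ cast {u} {∣ x ∣} {v} {∣ y ∣} eq ⟩
    + v * + ∣ y ∣ - + u * + ∣ x ∣           ≡⟨ cong₂ (λ p q → + v * q - + u * p) ∣x∣≡ ∣y∣≡ ⟩
    + v * (ρ * y) - + u * (σ * x)           ≡⟨ ring (+ u) σ x (+ v) ρ y ⟩
    x * (- (+ u * σ)) - (- (+ v * ρ)) * y   ≡⟨ det-≡ x y (- (+ v * ρ)) (- (+ u * σ)) ⟨
    det (x , y) (- (+ v * ρ) , - (+ u * σ)) ∎
    where
    ring : ∀ u σ x v ρ y → v * (ρ * y) - u * (σ * x) ≡ x * (- (u * σ)) - (- (v * ρ)) * y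
    ring = solve-∀

mod-reduce : ∀ a {c} → 0ℤ < c → ∃[ q ] 0ℤ ≤ a + q * c × a + q * c < c
mod-reduce a {+ 0} (+<+ ())
mod-reduce a {c@(+[1+ n ])} _ = - q , subst (0ℤ ≤_) r≡ (+≤+ ℕ.z≤n) , subst (_< c) r≡ (+<+ (n%ℕd<d a (ℕ.suc n)))
  where
  q = a /ℕ ℕ.suc n
  r = + (a %ℕ ℕ.suc n)
  ring : ∀ r q c → r ≡ (r + q * c) + (- q) * c
  ring = solve-∀
  r≡ : r ≡ a + (- q) * c
  r≡ = trans (ring r q c) (cong (_+ (- q) * c) (sym (a≡a%ℕn+[a/ℕn]*n a (ℕ.suc n))))

∣a∣²≡a² : ∀ a → + ∣ a ∣ * + ∣ a ∣ ≡ a * a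
∣a∣²≡a² (+ _)    = refl
∣a∣²≡a² -[1+ _ ] = refl

0≤-a-1 : ∀ {a} → a < 0ℤ → 0ℤ ≤ - a - 1ℤ
0≤-a-1 { -[1+ _ ] } _ = +≤+ ℕ.z≤n
0≤-a-1 {+ _} (+<+ ())

a²≡1⇒a≡±1 : ∀ a → a * a ≡ 1ℤ → a ≡ 1ℤ ⊎ a ≡ -1ℤ
a²≡1⇒a≡±1 (+ 1) _ = inj₁ refl
a²≡1⇒a≡±1 -[1+ 0 ] _ = inj₂ refl
a²≡1⇒a≡±1 (+ 0) ()
a²≡1⇒a≡±1 (+ ℕ.suc (ℕ.suc _)) ()
a²≡1⇒a≡±1 -[1+ ℕ.suc _ ] ()

+K-assoc : ∀ α β γ → (α +K β) +K γ ≡ α +K (β +K γ)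
+K-assoc (x , y) (z , w) (u , v) = cong₂ _,_ (+-assoc x z u) (+-assoc y w v)

+K-comm : ∀ α β → α +K β ≡ β +K α
+K-comm (x , y) (z , w) = cong₂ _,_ (+-comm x z) (+-comm y w)

sumK-++ : ∀ l m → sumK (l ++ m) ≡ sumK l +K sumK m
sumK-++ []      m = sym (cong₂ _,_ (+-identityˡ (proj₁ (sumK m))) (+-identityˡ (proj₂ (sumK m))))
sumK-++ (α ∷ l) m = trans (cong (α +K_) (sumK-++ l m)) (sym (+K-assoc α (sumK l) (sumK m)))

sumK-↭ : ∀ {l m} → l ↭ m → sumK l ≡ sumK m
sumK-↭ _↭_.refl = refl
sumK-↭ (prep α p) = cong (α +K_) (sumK-↭ p)
sumK-↭ (swap {l} {m} α β p) = begin
  α +K (β +K sumK l)   ≡⟨ +K-assoc α β (sumK l) ⟨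
  (α +K β) +K sumK l   ≡⟨ cong₂ _+K_ (+K-comm α β) (sumK-↭ p) ⟩
  (β +K α) +K sumK m   ≡⟨ +K-assoc β α (sumK m) ⟩
  β +K (α +K sumK m)   ∎
  where open ≡-Reasoning
sumK-↭ (_↭_.trans p q) = trans (sumK-↭ p) (sumK-↭ q)

sumK-replicate : ∀ n α → sumK (replicate n α) ≡ (+ n) · α
sumK-replicate 0         (x , y) = sym (cong₂ _,_ (*-zeroˡ x) (*-zeroˡ y))
sumK-replicate (ℕ.suc n) α       = trans (cong₂ _+K_ (sym (1· α)) (sumK-replicate n α)) (sym (·-distribʳ 1ℤ (+ n) α))

++-cancelʳ-↭ : ∀ {A : Set} (l : List A) {m n} → m ++ l ↭ n ++ l → m ↭ n
++-cancelʳ-↭ l {m} {n} p = cancelˡ l (↭-trans (++-comm l m) (↭-trans p (++-comm n l)))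
  where
  cancelˡ : ∀ l {m n} → l ++ m ↭ l ++ n → m ↭ n
  cancelˡ []      p = p
  cancelˡ (x ∷ l) p = cancelˡ l (drop-∷ p)

_≟K_ : DecidableEquality OK
_≟K_ = Product.≡-dec ℤ._≟_ ℤ._≟_

collect : ∀ {A : Set} → DecidableEquality A → (a : A) (l : List A) →
  ∃₂ λ n m → l ↭ replicate n a ++ m × All (a ≢_) m
collect _≟_ a [] = 0 , [] , ↭-refl , []
collect _≟_ a (b ∷ l) with a ≟ b | collect _≟_ a l
... | yes refl | n , m , p , a∉m = ℕ.suc n , m , prep a p , a∉m
... | no a≢b   | n , m , p , a∉m =
  n , b ∷ m , ↭-trans (prep b p) (↭-sym (shift b (replicate n a) m)) , a≢b ∷ a∉m

-- The final estimate for eβ + fγ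

-- For e > 0, (eb + 1)² exceeds (e + 1)²b by (b - 1)(e²b - 1), which is nonnegative, and eb + 1 ≤ s
-- + 1. For e = 0 the bound on eb is empty and 4b ≤ K takes over. The multiplicity of a summand will
-- be e + 1.
square-sum-bound : ∀ e {b s K} → K ≡ (s + 1ℤ) * (s + 1ℤ) → 0ℤ ≤ s → 0ℤ < b → + 4 * b ≤ K → + e * b ≤ s →
  +[1+ e ] * +[1+ e ] * b ≤ K
square-sum-bound 0 {b} {K = K} _ _ 0<b 4b≤K _ = ≤-by
  (+-mono-≤ (0≤* {+ 3} (+≤+ ℕ.z≤n) (<⇒≤ 0<b)) (i≤j⇒0≤j-i 4b≤K)) (ring b K)
  where
  ring : ∀ b K → K ≡ 1ℤ * 1ℤ * b + (+ 3 * b + (K - + 4 * b))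
  ring = solve-∀
square-sum-bound (ℕ.suc n) {b} {s} refl 0≤s 0<b _ eb≤s = ≤-trans
  (≤-by (0≤* 0≤b-1 (i≤j⇒0≤j-i 1≤e²b)) (ring (+[1+ n ]) b))
  (*-mono-≤ 0≤eb+1 (+-monoˡ-≤ 1ℤ eb≤s) 0≤eb+1 (+-monoˡ-≤ 1ℤ eb≤s))
  where
  0<e : 0ℤ < +[1+ n ]
  0<e = +<+ (ℕ.s≤s ℕ.z≤n)
  0≤b-1 : 0ℤ ≤ b - 1ℤ
  0≤b-1 = i≤j⇒0≤j-i (i<j⇒suc[i]≤j 0<b)
  1≤e²b : 1ℤ ≤ +[1+ n ] * +[1+ n ] * b
  1≤e²b = i<j⇒suc[i]≤j (0<* (0<* 0<e 0<e) 0<b)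
  0≤eb+1 : 0ℤ ≤ +[1+ n ] * b + 1ℤ
  0≤eb+1 = +-mono-≤ (<⇒≤ (0<* 0<e 0<b)) (+≤+ ℕ.z≤n)
  ring : ∀ e b → (e * b + 1ℤ) * (e * b + 1ℤ) ≡
    (1ℤ + e) * (1ℤ + e) * b + (b - 1ℤ) * (e * e * b - 1ℤ)
  ring = solve-∀

-- With E²b, F²c ≤ (s+1)², the identity (EFt)² = 4(E²b)(F²c) + E²F²Δ bounds the cross term EFt by (s+1)²(s+2).
form-bound : ∀ {E F b c t Δ s} → 0ℤ < E → 0ℤ < F → 0ℤ < b → 0ℤ < c → 0ℤ ≤ s →
  0ℤ ≤ Δ → Δ < (s + 1ℤ) * (s + 1ℤ) → t * t ≡ + 4 * (b * c) + Δ →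
  E * E * b ≤ (s + 1ℤ) * (s + 1ℤ) → F * F * c ≤ (s + 1ℤ) * (s + 1ℤ) →
  E * E * b + F * F * c + E * (F * t) ≤ (s + 1ℤ) * (s + 1ℤ) * (s + + 4)
form-bound {E} {F} {b} {c} {t} {Δ} {s} 0<E 0<F 0<b 0<c 0≤s 0≤Δ Δ<K t² E²b≤K F²c≤K =
  subst (E * E * b + F * F * c + E * (F * t) ≤_) (ring₁ K s) (+-mono-≤ (+-mono-≤ E²b≤K F²c≤K) EFt≤)
  where
  K : ℤ
  K = (s + 1ℤ) * (s + 1ℤ)
  0≤K : 0ℤ ≤ K
  0≤K = 0≤a² (s + 1ℤ)
  ring₁ : ∀ K s → K + K + K * (s + + 2) ≡ K * (s + + 4)
  ring₁ = solve-∀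
  square≤ : ∀ E {b} → 0ℤ < b → E * E * b ≤ K → E * E ≤ K
  square≤ E {b} 0<b E²b≤K = ≤-trans (≤-by (0≤* (0≤a² E) (i≤j⇒0≤j-i (i<j⇒suc[i]≤j 0<b))) (ring (E * E) b)) E²b≤K
    where
    ring : ∀ e b → e * b ≡ e + e * (b - 1ℤ)
    ring = solve-∀
  0≤E²b : 0ℤ ≤ E * E * b
  0≤E²b = 0≤* (0≤a² E) (<⇒≤ 0<b)
  0≤F²c : 0ℤ ≤ F * F * c
  0≤F²c = 0≤* (0≤a² F) (<⇒≤ 0<c)
  ring₂ : ∀ E F t → E * (F * t) * (E * (F * t)) ≡ E * E * (F * F) * (t * t)
  ring₂ = solve-∀
  ring₃ : ∀ E F b c Δ → E * E * (F * F) * (+ 4 * (b * c) + Δ) ≡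
    + 4 * (E * E * b * (F * F * c)) + E * E * (F * F) * Δ
  ring₃ = solve-∀
  -- This is (s + 2)² = 4 + (K - 1) + 2s multiplied by K²; the term with 2s is then dropped.
  ring₄ : ∀ s → let K = (s + 1ℤ) * (s + 1ℤ) in
    K * (s + + 2) * (K * (s + + 2)) ≡ + 4 * (K * K) + K * K * (K - 1ℤ) + K * K * (+ 2 * s)
  ring₄ = solve-∀
  Δ≤K-1 : Δ ≤ K - 1ℤ
  Δ≤K-1 = subst (Δ ≤_) (+-comm -1ℤ K) (i<j⇒i≤pred[j] Δ<K)
  EFt≤ : E * (F * t) ≤ K * (s + + 2)
  EFt≤ = square-cancel-≤ (0≤* 0≤K (+-mono-≤ 0≤s (+≤+ {0} ℕ.z≤n))) (begin
    E * (F * t) * (E * (F * t))                          ≡⟨ ring₂ E F t ⟩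
    E * E * (F * F) * (t * t)                            ≡⟨ cong (E * E * (F * F) *_) t² ⟩
    E * E * (F * F) * (+ 4 * (b * c) + Δ)                ≡⟨ ring₃ E F b c Δ ⟩
    + 4 * (E * E * b * (F * F * c)) + E * E * (F * F) * Δ
      ≤⟨ +-mono-≤ (*-monoˡ-≤-nonNeg (+ 4) (*-mono-≤ 0≤E²b E²b≤K 0≤F²c F²c≤K))
           (*-mono-≤ (0≤* (0≤a² E) (0≤a² F)) (*-mono-≤ (0≤a² E) (square≤ E 0<b E²b≤K) (0≤a² F) (square≤ F 0<c F²c≤K)) 0≤Δ Δ≤K-1) ⟩
    + 4 * (K * K) + K * K * (K - 1ℤ)
      ≤⟨ ≤-by (0≤* (0≤* 0≤K 0≤K) (0≤* {+ 2} (+≤+ ℕ.z≤n) 0≤s)) (ring₄ s) ⟩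
    K * (s + + 2) * (K * (s + + 2))                      ∎)
    where open ≤-Reasoning

-- Uniquely decomposable elements

-- The parameters ε, k treat both shapes of the ring of integers at once. The integer `s` is the
-- floor of √Δ, and the strict inequality `s * s < Δ` carries the fact that Δ is not a square.
module UniqueDecomposition
  (D : ℕ) (ε k : ℤ)
  (TotPos⇒P : ∀ α → TotPos D α → Form.P ε k α)
  (P⇒TotPos : ∀ α → Form.P ε k α → TotPos D α)
  (s : ℤ) (0≤s : 0ℤ ≤ s) (s²<Δ : s * s < Form.Δ ε k) (Δ<[s+1]² : Form.Δ ε k < (s + 1ℤ) * (s + 1ℤ))
  where

  open Form ε k

  0<Δ : 0ℤ < Δ
  0<Δ = ≤-<-trans (0≤a² s) s²<Δ

  open Positivity 0<Δ

  -- Indecomposable elements and bases containing them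

  Ind : OK → Set
  Ind = Indecomposable D

  Ind⇒P : ∀ {α} → Ind α → P α
  Ind⇒P {α} (tp , _) = TotPos⇒P α tp

  irreducible : ∀ {α} β γ → Ind α → P β → P γ → α ≢ β +K γ
  irreducible β γ (_ , ind) pβ pγ eq = ind (β , γ , P⇒TotPos β pβ , P⇒TotPos γ pγ , eq)

  -- The value n = 0 is included because the remainder `r` in `area≯1` may vanish.
  P-+· : ∀ {α β} n → P α → P β → 0ℤ ≤ n → P (α +K n · β)
  P-+· {α@(x , y)} {β@(z , w)} (+ 0) pα _ _ =
    subst P (sym (cong₂ _,_ (ring x z) (ring y w))) pα
    where
    ring : ∀ x y → x + 0ℤ * y ≡ x
    ring = solve-∀
  P-+· +[1+ n ] pα pβ _ = P-+ pα (P-· +[1+ n ] (+<+ (ℕ.s≤s ℕ.z≤n)) pβ)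

  -- For n ≥ 2, nβ = β + (n - 1)β is a forbidden splitting.
  indecomposable-multiple : ∀ {α β} n → Ind α → P β → 0ℤ < n → α ≡ n · β → n ≡ 1ℤ
  indecomposable-multiple (+ 0) _ _ (+<+ ()) _
  indecomposable-multiple (+ 1) _ _ _ _ = refl
  indecomposable-multiple {β = β} (+ ℕ.suc (ℕ.suc n)) ind pβ _ eq = contradiction
    (trans eq (trans (·-distribʳ 1ℤ +[1+ n ] β) (cong (_+K +[1+ n ] · β) (1· β))))
    (irreducible β (+[1+ n ] · β) ind pβ (P-· +[1+ n ] (+<+ (ℕ.s≤s ℕ.z≤n)) pβ))

  -- An indecomposable element is primitive by `indecomposable-multiple`, so the gcd in `bézout` is
  -- 1; gcd 0 would force norm 0.
  basis-completion : ∀ {β} → Ind β → ∃[ τ ] det β τ ≡ 1ℤ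
  basis-completion {x , y} ind with bézout x y
  ... | 0 , α , τ , β≡0α , _ = contradiction
    (subst (0ℤ <_) (trans (cong N β≡0α) (trans (N-· 0ℤ α) (*-zeroˡ (N α)))) (0<N (Ind⇒P ind))) (<-irrefl refl)
  ... | d@(ℕ.suc _) , α , τ , β≡dα , d≡det =
    τ , trans (sym d≡det) (indecomposable-multiple (+ d) ind (P-·⁻ (+ d) 0<d (subst P β≡dα (Ind⇒P ind))) 0<d β≡dα)
    where
    0<d : 0ℤ < + d
    0<d = +<+ (ℕ.s≤s ℕ.z≤n)

  -- Replacing τ by τ + qβ keeps the determinant and shifts the pairing by 2qN(β), so division with
  -- remainder reaches the window. It is used with m = 0 and m = s + 1.
  adapted-basis : ∀ {β} → Ind β → ∀ m →
    ∃[ τ ] det β τ ≡ 1ℤ × m ≤ ⟨ β , τ ⟩ × ⟨ β , τ ⟩ < m + + 2 * N β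
  adapted-basis {β} ind m with basis-completion ind
  ... | τ , det≡1 with mod-reduce (⟨ β , τ ⟩ - m) {+ 2 * N β} (0<* {+ 2} (+<+ (ℕ.s≤s ℕ.z≤n)) (0<N (Ind⇒P ind)))
  ... | q , 0≤r , r<2N = τ +K q · β ,
    trans (det-+ β τ (q · β)) (trans (cong₂ _+_ det≡1 (trans (det-· q β β) (trans (cong (q *_) (det-self β)) (*-zeroʳ q)))) (+-identityʳ 1ℤ)) ,
    ≤-by 0≤r t≡ ,
    <-by (0<b-a r<2N) (trans (ring₂ m (+ 2 * N β) (⟨ β , τ ⟩ - m + q * (+ 2 * N β))) (cong (_+ (+ 2 * N β - (⟨ β , τ ⟩ - m + q * (+ 2 * N β)))) (sym t≡)))
    where
    ring₁ : ∀ t q m c → t + q * c ≡ m + (t - m + q * c)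
    ring₁ = solve-∀
    ring₂ : ∀ m c r → m + c ≡ m + r + (c - r)
    ring₂ = solve-∀
    t≡ : ⟨ β , τ +K q · β ⟩ ≡ m + (⟨ β , τ ⟩ - m + q * (+ 2 * N β))
    t≡ = begin
      ⟨ β , τ +K q · β ⟩                      ≡⟨ ⟨⟩-+ β τ (q · β) ⟩
      ⟨ β , τ ⟩ + ⟨ β , q · β ⟩               ≡⟨ cong (λ t → ⟨ β , τ ⟩ + t) (trans (⟨⟩-· q β β) (cong (q *_) (⟨⟩-self β))) ⟩
      ⟨ β , τ ⟩ + q * (+ 2 * N β)             ≡⟨ ring₁ ⟨ β , τ ⟩ q m (+ 2 * N β) ⟩
      m + (⟨ β , τ ⟩ - m + q * (+ 2 * N β))   ∎
      where open ≡-Reasoning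

  gram-basis : ∀ β τ → det β τ * det β τ ≡ 1ℤ → ⟨ β , τ ⟩ * ⟨ β , τ ⟩ ≡ + 4 * (N β * N τ) + Δ
  gram-basis β τ d²≡1 = trans (gram β τ) (cong (λ e → + 4 * (N β * N τ) + e) (trans (cong (Δ *_) d²≡1) (*-identityʳ Δ)))

  Δ-nonsquare : ∀ t → t * t ≢ Δ
  Δ-nonsquare t t²≡Δ = no-square-between ∣t∣<s+1 s<∣t∣
    where
    0≤s+1 : 0ℤ ≤ s + 1ℤ
    0≤s+1 = +-mono-≤ 0≤s (+≤+ ℕ.z≤n)
    s<∣t∣ : s < + ∣ t ∣
    s<∣t∣ = ≰⇒> λ ∣t∣≤s → <⇒≱ s²<Δ (subst (_≤ s * s) (trans (∣a∣²≡a² t) t²≡Δ) (*-mono-≤ (+≤+ ℕ.z≤n) ∣t∣≤s (+≤+ ℕ.z≤n) ∣t∣≤s))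
    ∣t∣<s+1 : + ∣ t ∣ < s + 1ℤ
    ∣t∣<s+1 = ≰⇒> λ s+1≤∣t∣ → <⇒≱ Δ<[s+1]² (subst ((s + 1ℤ) * (s + 1ℤ) ≤_) (trans (∣a∣²≡a² t) t²≡Δ) (*-mono-≤ 0≤s+1 s+1≤∣t∣ 0≤s+1 s+1≤∣t∣))
    no-square-between : + ∣ t ∣ < s + 1ℤ → ¬ (s < + ∣ t ∣)
    no-square-between t<s+1 s<t = <⇒≱ t<s+1 (subst (_≤ + ∣ t ∣) (+-comm 1ℤ s) (i<j⇒suc[i]≤j s<t))

  -- N(τ) = 0 would make Δ the square of the pairing, so N(τ) ≤ -1, and Δ = t² - 4N(β)N(τ) gives the
  -- claim.
  4N≤Δ : ∀ β τ → 0ℤ < N β → det β τ * det β τ ≡ 1ℤ → N τ ≤ 0ℤ → + 4 * N β ≤ Δ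
  4N≤Δ β τ 0<Nβ d²≡1 Nτ≤0 = ≤-by
    (+-mono-≤ (0≤a² ⟨ β , τ ⟩) (0≤* (0≤* {+ 4} (+≤+ ℕ.z≤n) (<⇒≤ 0<Nβ)) 0≤-Nτ-1))
    (trans (ring₁ Δ (N β) (N τ)) (cong (λ t → + 4 * N β + (t + + 4 * N β * (- N τ - 1ℤ))) (sym (gram-basis β τ d²≡1))))
    where
    ring₁ : ∀ Δ b c → Δ ≡ + 4 * b + (+ 4 * (b * c) + Δ + + 4 * b * (- c - 1ℤ))
    ring₁ = solve-∀
    Nτ≢0 : N τ ≢ 0ℤ
    Nτ≢0 Nτ≡0 = Δ-nonsquare ⟨ β , τ ⟩ (trans (gram-basis β τ d²≡1)
      (trans (cong (λ c → + 4 * (N β * c) + Δ) Nτ≡0) (ring₂ (N β) Δ)))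
      where
      ring₂ : ∀ b Δ → + 4 * (b * 0ℤ) + Δ ≡ Δ
      ring₂ = solve-∀
    0≤-Nτ-1 : 0ℤ ≤ - N τ - 1ℤ
    0≤-Nτ-1 = 0≤-a-1 (≤∧≢⇒< Nτ≤0 Nτ≢0)

  ⟨⟩-complement : ∀ n β τ → ⟨ β , n · β +K -1ℤ · τ ⟩ ≡ n * (+ 2 * N β) - ⟨ β , τ ⟩
  ⟨⟩-complement n β τ = trans (⟨⟩-+ β (n · β) (-1ℤ · τ))
    (cong₂ _+_ (trans (⟨⟩-· n β β) (cong (n *_) (⟨⟩-self β))) (trans (⟨⟩-· -1ℤ β τ) (-1*i≡-i ⟨ β , τ ⟩)))

  det-complement : ∀ n β τ → det β (n · β +K -1ℤ · τ) ≡ - det β τ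
  det-complement n β τ = trans (det-+ β (n · β) (-1ℤ · τ)) (trans (cong₂ _+_
    (trans (det-· n β β) (trans (cong (n *_) (det-self β)) (*-zeroʳ n)))
    (trans (det-· -1ℤ β τ) (-1*i≡-i (det β τ)))) (+-identityˡ (- det β τ)))

  -- Passing from τ to nβ - τ reverses the orientation. For this reason `4N≤Δ` and `P-basis` ask
  -- only that the squared determinant be 1: they serve τ and its complement alike.
  det-complement² : ∀ n β τ → det β τ ≡ 1ℤ → det β (n · β +K -1ℤ · τ) * det β (n · β +K -1ℤ · τ) ≡ 1ℤ
  det-complement² n β τ det≡1 = cong₂ _*_ det≡-1 det≡-1
    where
    det≡-1 : det β (n · β +K -1ℤ · τ) ≡ -1ℤ
    det≡-1 = trans (det-complement n β τ) (cong -_ det≡1)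

  -- If Δ < 4N(β), then by `4N≤Δ` everything that forms a basis with β has positive norm. For τ with
  -- 0 ≤ t < 2N(β), both τ and β - τ also pair nonnegatively with β, so they are totally positive
  -- and split β.
  norm-bound : ∀ {β} → Ind β → + 4 * N β ≤ Δ
  norm-bound {β} ind = ≮⇒≥ (λ Δ<4N → let τ , det≡1 , 0≤t , t<2N = adapted-basis ind 0ℤ in decomposes Δ<4N τ det≡1 0≤t t<2N)
    where
    pβ : P β
    pβ = Ind⇒P ind
    ring : ∀ c t → 0ℤ + c - t ≡ 1ℤ * c - t
    ring = solve-∀
    decomposes : Δ < + 4 * N β → ∀ τ → det β τ ≡ 1ℤ → 0ℤ ≤ ⟨ β , τ ⟩ → ¬ (⟨ β , τ ⟩ < 0ℤ + + 2 * N β)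
    decomposes Δ<4N τ det≡1 0≤t t<2N = irreducible τ σ ind
      (P-criterion pβ (0<N′ τ (cong₂ _*_ det≡1 det≡1)) 0≤t)
      (P-criterion pβ (0<N′ σ (det-complement² 1ℤ β τ det≡1)) 0≤⟨β,σ⟩)
      (trans (sym (1· β)) (+K-complement (1ℤ · β) τ))
      where
      σ : OK
      σ = 1ℤ · β +K -1ℤ · τ
      0<N′ : ∀ ρ → det β ρ * det β ρ ≡ 1ℤ → 0ℤ < N ρ
      0<N′ ρ d²≡1 = ≰⇒> λ Nρ≤0 → <⇒≱ Δ<4N (4N≤Δ β ρ (0<N pβ) d²≡1 Nρ≤0)
      0≤⟨β,σ⟩ : 0ℤ ≤ ⟨ β , σ ⟩
      0≤⟨β,σ⟩ = subst (0ℤ ≤_) (sym (⟨⟩-complement 1ℤ β τ))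
        (<⇒≤ (subst (0ℤ <_) (ring (+ 2 * N β) ⟨ β , τ ⟩) (0<b-a t<2N)))

  -- A pairing t above √Δ makes 4N(β)N(τ) = t² - Δ positive, hence N(τ) too.
  P-basis : ∀ {β τ} → P β → det β τ * det β τ ≡ 1ℤ → s + 1ℤ ≤ ⟨ β , τ ⟩ → P τ
  P-basis {β} {τ} pβ d²≡1 s+1≤t = P-criterion pβ 0<Nτ (≤-trans 0≤s+1 s+1≤t)
    where
    0≤s+1 : 0ℤ ≤ s + 1ℤ
    0≤s+1 = +-mono-≤ 0≤s (+≤+ ℕ.z≤n)
    Δ<t² : Δ < ⟨ β , τ ⟩ * ⟨ β , τ ⟩
    Δ<t² = <-≤-trans Δ<[s+1]² (*-mono-≤ 0≤s+1 s+1≤t 0≤s+1 s+1≤t)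
    ring : ∀ b c Δ → + 4 * (b * c) + Δ - Δ ≡ c * (+ 4 * b)
    ring = solve-∀
    0<Nτ : 0ℤ < N τ
    0<Nτ = 0<a*b⇒0<a {b = + 4 * N β} (0≤* {+ 4} (+≤+ ℕ.z≤n) (<⇒≤ (0<N pβ)))
      (subst (0ℤ <_) (trans (cong (_- Δ) (gram-basis β τ d²≡1)) (ring (N β) (N τ) Δ)) (0<b-a Δ<t²))

  large-multiple : ∀ {β} → Ind β → ∀ n → s < (n - 1ℤ) * N β →
    ∃₂ λ σ τ → P σ × P τ × n · β ≡ σ +K τ × det β σ ≡ 1ℤ
  large-multiple {β} ind n s<[n-1]N =
    let τ , det≡1 , s+1≤t , t<s+1+2N = adapted-basis ind (s + 1ℤ) in
    τ , n · β +K -1ℤ · τ ,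
    P-basis (Ind⇒P ind) (cong₂ _*_ det≡1 det≡1) s+1≤t ,
    P-basis (Ind⇒P ind) (det-complement² n β τ det≡1)
      (subst (s + 1ℤ ≤_) (sym (⟨⟩-complement n β τ)) (s+1≤2nN-t ⟨ β , τ ⟩ t<s+1+2N)) ,
    +K-complement (n · β) τ , det≡1
    where
    s+1≤[n-1]N : s + 1ℤ ≤ (n - 1ℤ) * N β
    s+1≤[n-1]N = subst (_≤ (n - 1ℤ) * N β) (+-comm 1ℤ s) (i<j⇒suc[i]≤j s<[n-1]N)
    -- From t < s + 1 + 2b follows 2nb - t > 2(n - 1)b - (s + 1), and (n - 1)b ≥ s + 1 makes the
    -- right side at least s + 1.
    ring : ∀ n b t s → n * (+ 2 * b) - t ≡ s + 1ℤ + (+ 2 * ((n - 1ℤ) * b - (s + 1ℤ)) + (s + 1ℤ + + 2 * b - t))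
    ring = solve-∀
    s+1≤2nN-t : ∀ t → t < s + 1ℤ + + 2 * N β → s + 1ℤ ≤ n * (+ 2 * N β) - t
    s+1≤2nN-t t t< = ≤-by
      (+-mono-≤ (0≤* {+ 2} (+≤+ ℕ.z≤n) (i≤j⇒0≤j-i s+1≤[n-1]N)) (<⇒≤ (0<b-a t<)))
      (ring n (N β) t s)

  -- Lists of indecomposables with uniquely decomposable sum

  Decomposition : OK → Set
  Decomposition α = ∃[ l ] IsDecomposition D α l

  -- Indecomposability is not obviously decidable, so existence only holds up to double negation.
  decompose : ∀ α → P α → ¬ ¬ Decomposition α
  decompose α pα = go ∣ Tr α ∣ α pα (≤-reflexive (sym (0≤i⇒+∣i∣≡i (<⇒≤ (0<Tr pα)))))
    where
    -- The number n bounds the trace, which drops at each splitting because the other summand has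
    -- positive trace.
    go : ∀ n α → P α → Tr α ≤ + n → ¬ ¬ Decomposition α
    go 0 α pα Tr≤0 _ = <⇒≱ (0<Tr pα) Tr≤0
    -- If α had no decomposition, it would be indecomposable, since decompositions of the two parts
    -- of a splitting concatenate; but then α alone is a decomposition.
    go (ℕ.suc n) α pα Tr≤n none = none ([ α ] , ind ∷ [] , cong₂ _,_ (+-identityʳ (proj₁ α)) (+-identityʳ (proj₂ α)))
      where
      smaller : ∀ {β γ} → P γ → α ≡ β +K γ → Tr β ≤ + n
      smaller {β} {γ} pγ eq = i<j⇒i≤pred[j] (<-≤-trans (<-by (0<Tr pγ) (trans (cong Tr eq) (Tr-+ β γ))) Tr≤n)
      ind : Ind α
      ind = P⇒TotPos α pα , λ (β , γ , tβ , tγ , eq) →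
        go n β (TotPos⇒P β tβ) (smaller {β} {γ} (TotPos⇒P γ tγ) eq) λ (l , all-l , sum-l) →
        go n γ (TotPos⇒P γ tγ) (smaller {γ} {β} (TotPos⇒P β tβ) (trans eq (+K-comm β γ))) λ (m , all-m , sum-m) →
        none (l ++ m , All.++⁺ all-l all-m , trans (sumK-++ l m) (trans (cong₂ _+K_ sum-l sum-m) (sym eq)))

  -- Stated for the decomposition instead of its sum, so that it passes to permutations and to
  -- sublists.
  UD : List OK → Set
  UD l = All Ind l × (∀ m → All Ind m → sumK m ≡ sumK l → m ↭ l)

  UD-resp-↭ : ∀ {l m} → l ↭ m → UD l → UD m
  UD-resp-↭ p (all , unique) = All-resp-↭ p all ,
    λ m' all' eq → ↭-trans (unique m' all' (trans eq (sym (sumK-↭ p)))) p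

  -- A rival decomposition of the sum of `l` can be completed by `m`; uniqueness applies to the
  -- whole, and `m` cancels.
  UD-++ˡ : ∀ l m → UD (l ++ m) → UD l
  UD-++ˡ l m (all , unique) = All.++⁻ˡ l all , λ l' all' eq → ++-cancelʳ-↭ m
    (unique (l' ++ m) (All.++⁺ all' (All.++⁻ʳ l all))
      (trans (sumK-++ l' m) (trans (cong (_+K sumK m) eq) (sym (sumK-++ l m)))))

  UD-pair : ∀ {l β γ} → UD l → β ∈ l → γ ∈ l → β ≢ γ → UD (β ∷ γ ∷ [])
  UD-pair {l} {β} {γ} ud β∈l γ∈l β≢γ with ∈-∃++ β∈l
  ... | as , bs , refl with ∈-resp-↭ (shift β as bs) γ∈l
  ... | here γ≡β = contradiction (sym γ≡β) β≢γ
  ... | there γ∈m with ∈-∃++ γ∈m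
  ... | cs , ds , m≡ = UD-++ˡ (β ∷ γ ∷ []) (cs ++ ds) (UD-resp-↭
    (↭-trans (shift β as bs) (prep β (subst (_↭ γ ∷ cs ++ ds) (sym m≡) (shift γ cs ds)))) ud)

  ∣-det-sumK : ∀ {d} β {l} → All (λ γ → d ∣ det β γ) l → d ∣ det β (sumK l)
  ∣-det-sumK (x , y) [] = divides 0ℤ (trans (det-≡ x y 0ℤ 0ℤ) (ring x y))
    where
    ring : ∀ x y → x * 0ℤ - 0ℤ * y ≡ 0ℤ
    ring = solve-∀
  ∣-det-sumK {d} β {γ ∷ l} (d∣ ∷ ds) = subst (d ∣_) (sym (det-+ β γ (sumK l))) (∣m∣n⇒∣m+n d∣ (∣-det-sumK β ds))

  -- Every totally positive summand of a uniquely decomposable element is a subsum of its decomposition.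
  ∣-det-summand : ∀ {l σ τ d} β → UD l → P σ → P τ → sumK l ≡ σ +K τ →
    All (λ γ → d ∣ det β γ) l → ¬ ¬ (d ∣ det β σ)
  ∣-det-summand {l} {σ} {τ} {d} β (_ , unique) pσ pτ eq all d∤ =
    decompose σ pσ λ (m , all-m , sum-m) → decompose τ pτ λ (n , all-n , sum-n) →
    d∤ (subst (λ δ → d ∣ det β δ) sum-m (∣-det-sumK β (All.++⁻ˡ m (All-resp-↭ (↭-sym
      (unique (m ++ n) (All.++⁺ all-m all-n) (trans (sumK-++ m n) (trans (cong₂ _+K_ sum-m sum-n) (sym eq))))) all))))

  -- Otherwise `large-multiple` splits off a σ with det(β, σ) = 1, whereas any subsum of copies of β
  -- has determinant 0 with β.
  multiplicity-bound : ∀ {β} n → UD (replicate (ℕ.suc n) β) → + n * N β ≤ s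
  multiplicity-bound {β} n ud@(ind ∷ _ , _) = ≮⇒≥ λ s<nN →
    let σ , τ , pσ , pτ , eq , det≡1 = large-multiple ind +[1+ n ] s<nN in
    ∣-det-summand β ud pσ pτ (trans (sumK-replicate (ℕ.suc n) β) eq)
      -- The divisor is 0 here: divisibility by 0 expresses vanishing of the determinant.
      (All.replicate⁺ (ℕ.suc n) (divides 0ℤ (det-self β)))
      λ 0∣det → contradiction (trans (sym det≡1) (0∣⇒≡0 0∣det)) λ ()

  -- In a basis (β, τ) the τ-coordinate of γ is det(β, γ) = 0, so γ = uβ. Traces give u > 0, and
  -- indecomposability u = 1.
  proportional : ∀ {β γ} → Ind β → Ind γ → det β γ ≡ 0ℤ → β ≡ γ
  proportional {β} {γ} indβ indγ det≡0 with basis-completion indβ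
  ... | τ , det≡1 = sym (trans γ≡uβ (trans (cong (_· β) u≡1) (1· β)))
    where
    u : ℤ
    u = det γ τ
    ring : ∀ u x y → u * x + 0ℤ * y ≡ u * x
    ring = solve-∀
    γ≡uβ : γ ≡ u · β
    γ≡uβ = begin
      γ                           ≡⟨ basis-expansion γ det≡1 ⟩
      u · β +K det β γ · τ        ≡⟨ cong (λ d → u · β +K d · τ) det≡0 ⟩
      u · β +K 0ℤ · τ             ≡⟨ cong₂ _,_ (ring u (proj₁ β) (proj₁ τ)) (ring u (proj₂ β) (proj₂ τ)) ⟩
      u · β                       ∎
      where open ≡-Reasoning
    u≡1 : u ≡ 1ℤ
    u≡1 = indecomposable-multiple u indγ (Ind⇒P indβ)
      (0<a*b⇒0<a (<⇒≤ (0<Tr (Ind⇒P indβ))) (subst (0ℤ <_) (trans (cong Tr γ≡uβ) (Tr-· u β)) (0<Tr (Ind⇒P indγ)))) γ≡uβ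

  -- If d = det β γ > 1 then β + γ has a totally positive summand (γ + (d - r)β)/d with 0 ≤ r < d,
  -- whose determinant with β is 1, so that it is not a subsum of β + γ.
  area≯1 : ∀ {β γ} → UD (β ∷ γ ∷ []) → ¬ (1ℤ < det β γ)
  area≯1 {β} {γ} ud@(indβ ∷ indγ ∷ [] , _) 1<d =
    let τ , det≡1 = basis-completion indβ
        q , 0≤r , r<d = mod-reduce (det γ τ) 0<d
    in impossible τ det≡1 q 0≤r r<d
    where
    d : ℤ
    d = det β γ
    0<d : 0ℤ < d
    0<d = <-trans (+<+ (ℕ.s≤s ℕ.z≤n)) 1<d
    d∤1 : ¬ (d ∣ 1ℤ)
    d∤1 d∣1 = <-irrefl (sym (trans (sym (0≤i⇒+∣i∣≡i (<⇒≤ 0<d))) (cong +_ (ℕ.∣1⇒≡1 (∣⇒∣ᵤ d∣1))))) 1<d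
    ring₁ : ∀ d q u x t → d * (t + (1ℤ - q) * x) ≡ (u * x + d * t) + (d - (u + q * d)) * x
    ring₁ = solve-∀
    ring₂ : ∀ d q u x t → d * (x + (u * x + d * t) + -1ℤ * (t + (1ℤ - q) * x)) ≡
      (d - 1ℤ) * (u * x + d * t) + (u + q * d) * x
    ring₂ = solve-∀
    impossible : ∀ τ → det β τ ≡ 1ℤ → ∀ q → 0ℤ ≤ det γ τ + q * d → ¬ (det γ τ + q * d < d)
    impossible τ det≡1 q 0≤r r<d =
      -- Both det(β, β) = 0 and det(β, γ) = d are divisible by d, but det(β, σ) = 1 is not.
      ∣-det-summand β ud pσ pρ sum≡ (divides 0ℤ (det-self β) ∷ ∣-refl ∷ [])
        λ d∣det → d∤1 (subst (d ∣_) detσ≡1 d∣det)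
      where
      u : ℤ
      u = det γ τ
      r : ℤ
      r = u + q * d
      σ ρ : OK
      -- Substituting γ = uβ + dτ gives dσ = γ + (d - r)β and dρ = (d - 1)γ + rβ. Positivity is
      -- checked on these multiples, which avoids division.
      σ = τ +K (1ℤ - q) · β
      ρ = (β +K γ) +K -1ℤ · σ
      γ≡ : γ ≡ u · β +K d · τ
      γ≡ = basis-expansion γ det≡1
      dσ≡ : d · σ ≡ γ +K (d - r) · β
      dσ≡ = trans (cong₂ _,_ (ring₁ d q u (proj₁ β) (proj₁ τ)) (ring₁ d q u (proj₂ β) (proj₂ τ)))
        (cong (_+K (d - r) · β) (sym γ≡))
      dρ≡ : d · ρ ≡ (d - 1ℤ) · γ +K r · β
      dρ≡ = trans (cong (λ γ → d · ((β +K γ) +K -1ℤ · σ)) γ≡)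
        (trans (cong₂ _,_ (ring₂ d q u (proj₁ β) (proj₁ τ)) (ring₂ d q u (proj₂ β) (proj₂ τ)))
        (cong (λ γ → (d - 1ℤ) · γ +K r · β) (sym γ≡)))
      pσ : P σ
      pσ = P-·⁻ d 0<d (subst P (sym dσ≡) (P-+· (d - r) (Ind⇒P indγ) (Ind⇒P indβ) (<⇒≤ (0<b-a r<d))))
      pρ : P ρ
      pρ = P-·⁻ d 0<d (subst P (sym dρ≡) (P-+· r (P-· (d - 1ℤ) (0<b-a 1<d) (Ind⇒P indγ)) (Ind⇒P indβ) 0≤r))
      sum≡ : sumK (β ∷ γ ∷ []) ≡ σ +K ρ
      sum≡ = trans (cong (β +K_) (cong₂ _,_ (+-identityʳ (proj₁ γ)) (+-identityʳ (proj₂ γ)))) (+K-complement (β +K γ) σ)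
      detσ≡1 : det β σ ≡ 1ℤ
      detσ≡1 = trans (det-+ β τ ((1ℤ - q) · β)) (cong₂ _+_ det≡1
        (trans (det-· (1ℤ - q) β β) (trans (cong ((1ℤ - q) *_) (det-self β)) (*-zeroʳ (1ℤ - q)))))

  positive-area : ∀ {β γ} → UD (β ∷ γ ∷ []) → 0ℤ < det β γ → det β γ ≡ 1ℤ
  positive-area ud 0<d = ≤-antisym (≮⇒≥ (area≯1 ud)) (i<j⇒suc[i]≤j 0<d)

  -- Determinant 0 is excluded by `proportional`; a negative one becomes positive on exchanging β
  -- and γ.
  unit-area : ∀ {β γ} → UD (β ∷ γ ∷ []) → β ≢ γ → det β γ * det β γ ≡ 1ℤ
  unit-area {β} {γ} ud@(indβ ∷ indγ ∷ [] , _) β≢γ with <-cmp 0ℤ (det β γ)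
  ... | tri< 0<d _ _ = cong₂ _*_ d≡1 d≡1
    where
    d≡1 : det β γ ≡ 1ℤ
    d≡1 = positive-area ud 0<d
  ... | tri≈ _ 0≡d _ = contradiction (proportional indβ indγ (sym 0≡d)) β≢γ
  ... | tri> _ _ d<0 = cong₂ _*_ d≡-1 d≡-1
    where
    d≡-1 : det β γ ≡ -1ℤ
    d≡-1 = trans (det-swap γ β) (cong -_ (positive-area (UD-resp-↭ (swap β γ ↭-refl) ud)
      (subst (0ℤ <_) (sym (det-swap β γ)) (neg-mono-< d<0))))

  -- All pairwise determinants are ±1, so `cramer` gives δ = uβ + vγ with u, v = ±1. Three of the
  -- sign patterns write one of the elements as the sum of the other two; the fourth gives β + γ + δ
  -- = 0, against positive traces.
  no-three-summands : ∀ {l β γ δ} → UD l → β ∈ l → γ ∈ l → δ ∈ l → β ≢ γ → β ≢ δ → ¬ (γ ≢ δ)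
  no-three-summands {β = β} {γ} {δ} ud β∈ γ∈ δ∈ β≢γ β≢δ γ≢δ =
    impossible (a²≡1⇒a≡±1 u u²≡1) (a²≡1⇒a≡±1 v v²≡1)
    where
    udβγ = UD-pair ud β∈ γ∈ β≢γ
    udβδ = UD-pair ud β∈ δ∈ β≢δ
    udγδ = UD-pair ud γ∈ δ∈ γ≢δ
    a b c u v : ℤ
    a = det β γ
    b = det δ γ
    c = det β δ
    u = a * b
    v = a * c
    a²≡1 : a * a ≡ 1ℤ
    a²≡1 = unit-area udβγ β≢γ
    b²≡1 : b * b ≡ 1ℤ
    b²≡1 = trans (cong₂ _*_ (det-swap γ δ) (det-swap γ δ)) (trans (ring (det γ δ)) (unit-area udγδ γ≢δ))
      where
      ring : ∀ a → - a * - a ≡ a * a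
      ring = solve-∀
    c²≡1 : c * c ≡ 1ℤ
    c²≡1 = unit-area udβδ β≢δ
    ring₁ : ∀ a b → a * b * (a * b) ≡ a * a * (b * b)
    ring₁ = solve-∀
    u²≡1 : u * u ≡ 1ℤ
    u²≡1 = trans (ring₁ a b) (cong₂ _*_ a²≡1 b²≡1)
    v²≡1 : v * v ≡ 1ℤ
    v²≡1 = trans (ring₁ a c) (cong₂ _*_ a²≡1 c²≡1)
    indβ : Ind β
    indβ = All.head (proj₁ udβγ)
    indγ : Ind γ
    indγ = All.head (proj₁ udγδ)
    indδ : Ind δ
    indδ = All.head (All.tail (proj₁ udβδ))
    δ≡ : δ ≡ u · β +K v · γ
    δ≡ = begin
      δ                           ≡⟨ 1· δ ⟨
      1ℤ · δ                      ≡⟨ cong (_· δ) a²≡1 ⟨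
      (a * a) · δ                 ≡⟨ cong₂ _,_ (*-assoc a a (proj₁ δ)) (*-assoc a a (proj₂ δ)) ⟩
      a · (a · δ)                 ≡⟨ cong (a ·_) (cramer β γ δ) ⟩
      a · (b · β +K c · γ)        ≡⟨ cong₂ _,_ (ring a b c (proj₁ β) (proj₁ γ)) (ring a b c (proj₂ β) (proj₂ γ)) ⟩
      u · β +K v · γ              ∎
      where
      open ≡-Reasoning
      ring : ∀ a b c x z → a * (b * x + c * z) ≡ a * b * x + a * c * z
      ring = solve-∀
    impossible : u ≡ 1ℤ ⊎ u ≡ -1ℤ → ¬ (v ≡ 1ℤ ⊎ v ≡ -1ℤ)
    impossible (inj₁ u≡1) (inj₁ v≡1) = irreducible β γ indδ (Ind⇒P indβ) (Ind⇒P indγ)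
      (trans δ≡ (cong₂ _+K_ (trans (cong (_· β) u≡1) (1· β)) (trans (cong (_· γ) v≡1) (1· γ))))
    impossible (inj₁ u≡1) (inj₂ v≡-1) = irreducible γ δ indβ (Ind⇒P indγ) (Ind⇒P indδ)
      (trans (+K-complement β γ) (cong (γ +K_) (sym (trans δ≡ (cong₂ _+K_ (trans (cong (_· β) u≡1) (1· β)) (cong (_· γ) v≡-1))))))
    impossible (inj₂ u≡-1) (inj₁ v≡1) = irreducible β δ indγ (Ind⇒P indβ) (Ind⇒P indδ)
      (trans (+K-complement γ β) (cong (β +K_) (sym (trans δ≡ (trans (+K-comm (u · β) (v · γ))
        (cong₂ _+K_ (trans (cong (_· γ) v≡1) (1· γ)) (cong (_· β) u≡-1)))))))
    impossible (inj₂ u≡-1) (inj₂ v≡-1) = <-irrefl refl (subst (0ℤ <_)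
      (trans (cong (λ t → t + (Tr β + Tr γ)) Trδ≡) (ring (Tr β) (Tr γ)))
      (+-mono-< (0<Tr (Ind⇒P indδ)) (+-mono-< (0<Tr (Ind⇒P indβ)) (0<Tr (Ind⇒P indγ)))))
      where
      ring : ∀ x y → -1ℤ * x + -1ℤ * y + (x + y) ≡ 0ℤ
      ring = solve-∀
      Trδ≡ : Tr δ ≡ -1ℤ * Tr β + -1ℤ * Tr γ
      Trδ≡ = trans (cong Tr (trans δ≡ (cong₂ (λ u v → u · β +K v · γ) u≡-1 v≡-1)))
        (trans (Tr-+ (-1ℤ · β) (-1ℤ · γ)) (cong₂ _+_ (Tr-· -1ℤ β) (Tr-· -1ℤ γ)))

  -- Norm bounds by number of distinct summands

  N≤[s+1]² : ∀ {β} n → UD (replicate (ℕ.suc n) β) → +[1+ n ] * +[1+ n ] * N β ≤ (s + 1ℤ) * (s + 1ℤ)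
  N≤[s+1]² n ud@(ind ∷ _ , _) = square-sum-bound n refl 0≤s (0<N (Ind⇒P ind))
    (≤-trans (norm-bound ind) (<⇒≤ Δ<[s+1]²)) (multiplicity-bound n ud)

  N-combination : ∀ E F β γ → N (E · β +K F · γ) ≡ E * E * N β + F * F * N γ + E * (F * ⟨ β , γ ⟩)
  N-combination E F β γ = trans (N-+ (E · β) (F · γ)) (cong₂ _+_ (cong₂ _+_ (N-· E β) (N-· F γ)) (begin
    ⟨ E · β , F · γ ⟩         ≡⟨ ⟨⟩-· F (E · β) γ ⟩
    F * ⟨ E · β , γ ⟩         ≡⟨ cong (F *_) (⟨⟩-comm (E · β) γ) ⟩
    F * ⟨ γ , E · β ⟩         ≡⟨ cong (F *_) (⟨⟩-· E γ β) ⟩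
    F * (E * ⟨ γ , β ⟩)       ≡⟨ cong (λ t → F * (E * t)) (⟨⟩-comm γ β) ⟩
    F * (E * ⟨ β , γ ⟩)       ≡⟨ ring F E ⟨ β , γ ⟩ ⟩
    E * (F * ⟨ β , γ ⟩)       ∎))
    where
    open ≡-Reasoning
    ring : ∀ F E t → F * (E * t) ≡ E * (F * t)
    ring = solve-∀

  N-bound-one : ∀ {β} n → UD (replicate (ℕ.suc n) β) →
    N (sumK (replicate (ℕ.suc n) β)) ≤ (s + 1ℤ) * (s + 1ℤ) * (s + + 4)
  N-bound-one {β} n ud = begin
    N (sumK (replicate (ℕ.suc n) β))       ≡⟨ cong N (sumK-replicate (ℕ.suc n) β) ⟩
    N (+[1+ n ] · β)                       ≡⟨ N-· +[1+ n ] β ⟩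
    +[1+ n ] * +[1+ n ] * N β              ≤⟨ N≤[s+1]² n ud ⟩
    (s + 1ℤ) * (s + 1ℤ)                    ≤⟨ ≤-by (0≤* (0≤a² (s + 1ℤ)) (+-mono-≤ 0≤s (+≤+ {0} {3} ℕ.z≤n))) (ring s) ⟩
    (s + 1ℤ) * (s + 1ℤ) * (s + + 4)        ∎
    where
    open ≤-Reasoning
    ring : ∀ s → let K = (s + 1ℤ) * (s + 1ℤ) in K * (s + + 4) ≡ K + K * (s + + 3)
    ring = solve-∀

  N-bound-two : ∀ {β γ} m n → β ≢ γ → UD (replicate (ℕ.suc m) β ++ replicate (ℕ.suc n) γ) →
    N (sumK (replicate (ℕ.suc m) β ++ replicate (ℕ.suc n) γ)) ≤ (s + 1ℤ) * (s + 1ℤ) * (s + + 4)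
  N-bound-two {β} {γ} m n β≢γ ud = begin
    N (sumK (βs ++ γs))                       ≡⟨ cong N (sumK-++ βs γs) ⟩
    N (sumK βs +K sumK γs)                    ≡⟨ cong₂ (λ σ τ → N (σ +K τ)) (sumK-replicate (ℕ.suc m) β) (sumK-replicate (ℕ.suc n) γ) ⟩
    N (E · β +K F · γ)                        ≡⟨ N-combination E F β γ ⟩
    E * E * N β + F * F * N γ + E * (F * ⟨ β , γ ⟩)
      ≤⟨ form-bound {E} {F} (+<+ (ℕ.s≤s ℕ.z≤n)) (+<+ (ℕ.s≤s ℕ.z≤n)) (0<N (Ind⇒P (All.head (proj₁ ud-βs)))) (0<N (Ind⇒P (All.head (proj₁ ud-γs))))
           0≤s (<⇒≤ 0<Δ) Δ<[s+1]² (gram-basis β γ (unit-area ud-pair β≢γ)) (N≤[s+1]² m ud-βs) (N≤[s+1]² n ud-γs) ⟩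
    (s + 1ℤ) * (s + 1ℤ) * (s + + 4)           ∎
    where
    open ≤-Reasoning
    E F : ℤ
    E = +[1+ m ]
    F = +[1+ n ]
    βs γs : List OK
    βs = replicate (ℕ.suc m) β
    γs = replicate (ℕ.suc n) γ
    ud-βs : UD βs
    ud-βs = UD-++ˡ βs γs ud
    ud-γs : UD γs
    ud-γs = UD-++ˡ γs βs (UD-resp-↭ (++-comm βs γs) ud)
    ud-pair : UD (β ∷ γ ∷ [])
    ud-pair = UD-pair ud (here refl) (∈-++⁺ʳ βs (here refl)) β≢γ

  -- Collecting the copies of the first element, then those of the next different one, either
  -- exhausts the list or exhibits a third distinct summand, which `no-three-summands` excludes.
  N-bound : ∀ l → UD l → N (sumK l) ≤ (s + 1ℤ) * (s + 1ℤ) * (s + + 4)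
  N-bound [] _ = subst (_≤ (s + 1ℤ) * (s + 1ℤ) * (s + + 4)) (sym (trans (N-· 0ℤ zeroK) (*-zeroˡ (N zeroK))))
    (0≤* (0≤a² (s + 1ℤ)) (+-mono-≤ 0≤s (+≤+ {0} {4} ℕ.z≤n)))
  N-bound (β ∷ l) ud with collect _≟K_ β l
  ... | m , [] , p , _ = subst (λ σ → N σ ≤ (s + 1ℤ) * (s + 1ℤ) * (s + + 4)) (sym (sumK-↭ q)) (N-bound-one m (UD-resp-↭ q ud))
    where
    q : β ∷ l ↭ replicate (ℕ.suc m) β
    q = prep β (subst (l ↭_) (++-identityʳ (replicate m β)) p)
  ... | m , γ ∷ l′ , p , β≢γ ∷ β∉l′ with collect _≟K_ γ l′
  ...   | n , [] , p′ , _ = subst (λ σ → N σ ≤ (s + 1ℤ) * (s + 1ℤ) * (s + + 4)) (sym (sumK-↭ q)) (N-bound-two m n β≢γ (UD-resp-↭ q ud))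
    where
    q : β ∷ l ↭ replicate (ℕ.suc m) β ++ replicate (ℕ.suc n) γ
    q = ↭-trans (prep β p) (++⁺ˡ (replicate (ℕ.suc m) β) (prep γ (subst (l′ ↭_) (++-identityʳ (replicate n γ)) p′)))
  ...   | n , δ ∷ l″ , p′ , γ≢δ ∷ _ = contradiction γ≢δ (no-three-summands (UD-resp-↭ q ud) (here refl)
    (∈-++⁺ʳ (replicate (ℕ.suc m) β) (here refl))
    (∈-++⁺ʳ (replicate (ℕ.suc m) β) (∈-++⁺ʳ (replicate (ℕ.suc n) γ) (here refl)))
    β≢γ (All.head (All.++⁻ʳ (replicate n γ) (All-resp-↭ p′ β∉l′))))
    where
    q : β ∷ l ↭ replicate (ℕ.suc m) β ++ replicate (ℕ.suc n) γ ++ δ ∷ l″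
    q = ↭-trans (prep β p) (++⁺ˡ (replicate (ℕ.suc m) β) (prep γ p′))

-- Passage to 𝒪_K and √Δ

sqrt-floor : ∀ n → ∃[ s ] s ℕ.* s ℕ.≤ n × n ℕ.< ℕ.suc s ℕ.* ℕ.suc s
sqrt-floor 0 = 0 , ℕ.z≤n , ℕ.s≤s ℕ.z≤n
sqrt-floor (ℕ.suc n) with sqrt-floor n
... | s , s²≤n , n<[s+1]² with ℕ.suc n ℕ.<? ℕ.suc s ℕ.* ℕ.suc s
...   | yes n+1<[s+1]² = s , ℕ.m≤n⇒m≤1+n s²≤n , n+1<[s+1]²
...   | no n+1≮[s+1]² = ℕ.suc s , ℕ.≮⇒≥ n+1≮[s+1]² ,
  ℕ.≤-<-trans n<[s+1]² (ℕ.*-mono-< (ℕ.n<1+n (ℕ.suc s)) (ℕ.n<1+n (ℕ.suc s)))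

squarefree-nonsquare : ∀ {D} → 2 ℕ.≤ D → SquareFree D → ∀ t → t ℕ.* t ≢ D
squarefree-nonsquare 2≤D sf t refl with sf t ℕ.∣-refl
... | refl = contradiction 2≤D λ { (ℕ.s≤s ()) }

halve-square : ∀ t D → t ℕ.* t ≡ 4 ℕ.* D → ∃[ q ] q ℕ.* q ≡ D
halve-square t D t²≡4D with reduce (euclidsLemma t t prime[2] (ℕ.∣-trans (ℕ.divides 2 refl) (subst (4 ℕ.∣_) (sym t²≡4D) (ℕ.m∣m*n D))))
... | ℕ.divides q refl = q , ℕ.*-cancelˡ-≡ (q ℕ.* q) D 4 (trans (ring q) t²≡4D)
  where
  ring : ∀ q → 4 ℕ.* (q ℕ.* q) ≡ q ℕ.* 2 ℕ.* (q ℕ.* 2)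
  ring = solveℕ-∀

disc-nonsquare : ∀ {D} → 2 ℕ.≤ D → SquareFree D → ∀ t → t ℕ.* t ≢ disc D
disc-nonsquare {D} 2≤D sf t t²≡ with D≡1mod4? D
... | yes _ = squarefree-nonsquare 2≤D sf t t²≡
... | no _ = let q , q²≡D = halve-square t D t²≡ in squarefree-nonsquare 2≤D sf q q²≡D

-- `TotPos D α` computes to `PosConj D (twice D α)`, so rewriting `twice D α` treats both conjugates
-- at once.
PosConj : ℕ → ZS → Set
PosConj m (a , b) = Pos m (a , b) × Pos m (a , - b)

-- If b is nonzero, one of a ± b√m has a negative second coordinate, and the only clause of `Pos`
-- open to it contains the claim.
PosConj⇒ : ∀ {m} a b → PosConj m (a , b) → 0ℤ < a × + m * (b * b) < a * a
PosConj⇒ {m} a (+ 0) (inj₁ (0<a , _) , _) = 0<a , subst (_< a * a) (sym (*-zeroʳ (+ m))) (0<* 0<a 0<a)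
PosConj⇒ a (+ 0) (inj₂ (inj₁ (_ , +<+ ())) , _)
PosConj⇒ a (+ 0) (inj₂ (inj₂ (inj₁ (_ , +<+ () , _))) , _)
PosConj⇒ a (+ 0) (inj₂ (inj₂ (inj₂ (_ , +<+ () , _))) , _)
PosConj⇒ a +[1+ n ] (_ , inj₂ (inj₂ (inj₁ (0<a , _ , mb²<a²)))) = 0<a , mb²<a²
PosConj⇒ a +[1+ n ] (_ , inj₁ (_ , ()))
PosConj⇒ a +[1+ n ] (_ , inj₂ (inj₁ (_ , ())))
PosConj⇒ a +[1+ n ] (_ , inj₂ (inj₂ (inj₂ (_ , () , _))))
PosConj⇒ a -[1+ n ] (inj₂ (inj₂ (inj₁ (0<a , _ , mb²<a²))) , _) = 0<a , mb²<a²
PosConj⇒ a -[1+ n ] (inj₁ (_ , ()) , _)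
PosConj⇒ a -[1+ n ] (inj₂ (inj₁ (_ , ())) , _)
PosConj⇒ a -[1+ n ] (inj₂ (inj₂ (inj₂ (_ , () , _))) , _)

⇒PosConj : ∀ {m} a b → 0ℤ < a → + m * (b * b) < a * a → PosConj m (a , b)
⇒PosConj a (+ 0)    0<a _ = inj₁ (0<a , ≤-refl) , inj₁ (0<a , ≤-refl)
⇒PosConj a +[1+ n ] 0<a lt = inj₁ (0<a , +≤+ ℕ.z≤n) , inj₂ (inj₂ (inj₁ (0<a , ℤ.-<+ , lt)))
⇒PosConj a -[1+ n ] 0<a lt = inj₂ (inj₂ (inj₁ (0<a , ℤ.-<+ , lt))) , inj₁ (0<a , +≤+ ℕ.z≤n)

bound-≡ : ∀ Δ → bound Δ ≡ (+ 7 * + Δ , + 6 * + Δ + + 2)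
bound-≡ Δ = cong₂ _,_ (ring₁ (+ Δ)) (ring₂ (+ Δ))
  where
  -- The letters replay `mulS`: a is 2√Δ + 1, b is 3√Δ + 2, and c is √Δ times a.
  ring₁ : ∀ d → let a₁ = + 2 * 0ℤ + d * (0ℤ * + 1) + + 1
                    a₂ = + 2 * + 1 + 0ℤ * 0ℤ + 0ℤ
                    b₁ = + 3 * 0ℤ + d * (0ℤ * + 1) + + 2
                    b₂ = + 3 * + 1 + 0ℤ * 0ℤ + 0ℤ
                    c₁ = 0ℤ * a₁ + d * (+ 1 * a₂)
                    c₂ = 0ℤ * a₂ + + 1 * a₁
                in c₁ * b₁ + d * (c₂ * b₂) ≡ + 7 * d
  ring₁ = solve-∀
  ring₂ : ∀ d → let a₁ = + 2 * 0ℤ + d * (0ℤ * + 1) + + 1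
                    a₂ = + 2 * + 1 + 0ℤ * 0ℤ + 0ℤ
                    b₁ = + 3 * 0ℤ + d * (0ℤ * + 1) + + 2
                    b₂ = + 3 * + 1 + 0ℤ * 0ℤ + 0ℤ
                    c₁ = 0ℤ * a₁ + d * (+ 1 * a₂)
                    c₂ = 0ℤ * a₂ + + 1 * a₁
                in c₁ * b₂ + c₂ * b₁ ≡ + 6 * d + + 2
  ring₂ = solve-∀

-- A lower bound s for √Δ turns x + y√Δ > 0 into an inequality between integers.
Pos-by-sqrt : ∀ {Δ s x y} → 0ℤ ≤ s → s * s < + Δ → 0ℤ < y → 0ℤ ≤ x + s * y → Pos Δ (x , y)
Pos-by-sqrt {Δ} {s} {x} {y} 0≤s s²<Δ 0<y 0≤x+sy with 0ℤ ℤ.≤? x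
... | yes 0≤x = inj₂ (inj₁ (0≤x , 0<y))
... | no 0≰x = inj₂ (inj₂ (inj₂ (x<0 , 0<y , (begin-strict
  x * x              ≡⟨ ring₁ x ⟩
  - x * - x          ≤⟨ *-mono-≤ 0≤-x -x≤sy 0≤-x -x≤sy ⟩
  s * y * (s * y)    ≡⟨ ring₂ s y ⟩
  s * s * (y * y)    <⟨ <-by (0<* (0<b-a s²<Δ) (0<* 0<y 0<y)) (ring₃ (+ Δ) (s * s) (y * y)) ⟩
  + Δ * (y * y)      ∎))))
  where
  open ≤-Reasoning
  x<0 : x < 0ℤ
  x<0 = ≰⇒> 0≰x
  0≤-x : 0ℤ ≤ - x
  0≤-x = neg-mono-≤ (<⇒≤ x<0)
  ring₁ : ∀ x → x * x ≡ - x * - x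
  ring₁ = solve-∀
  ring₂ : ∀ s y → s * y * (s * y) ≡ s * s * (y * y)
  ring₂ = solve-∀
  ring₃ : ∀ d a b → d * b ≡ a * b + (d - a) * b
  ring₃ = solve-∀
  ring₄ : ∀ x t → t ≡ - x + (x + t)
  ring₄ = solve-∀
  -x≤sy : - x ≤ s * y
  -x≤sy = ≤-by 0≤x+sy (ring₄ x (s * y))

below-bound : ∀ {Δ s} n → s ℕ.* s ℕ.< Δ → n ≤ (+ s + 1ℤ) * (+ s + 1ℤ) * (+ s + + 4) → n <ₛ (Δ , bound Δ)
below-bound {Δ} {s} n s²<Δ n≤ = subst (λ q → Pos Δ (q ⊖ (n , 0ℤ))) (sym (bound-≡ Δ))
  (Pos-by-sqrt {s = + s} (+≤+ ℕ.z≤n) +s²<Δ 0<6Δ+2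
    (subst (0ℤ ≤_) (sym (ring₁ (+ Δ) (+ s) n)) (+-mono-≤ (+-mono-≤ (0≤* 0≤6s+7 (i≤j⇒0≤j-i s²+1≤Δ)) 0≤rest) (i≤j⇒0≤j-i n≤))))
  where
  +s²<Δ : + s * + s < + Δ
  +s²<Δ = subst (_< + Δ) (pos-* s s) (+<+ s²<Δ)
  s²+1≤Δ : 1ℤ + + s * + s ≤ + Δ
  s²+1≤Δ = i<j⇒suc[i]≤j +s²<Δ
  0<6Δ+2 : 0ℤ < + 6 * + Δ + + 2 - 0ℤ
  0<6Δ+2 = +-mono-<-≤ (+-mono-≤-< (0≤* {+ 6} {+ Δ} (+≤+ ℕ.z≤n) (+≤+ ℕ.z≤n)) (+<+ {0} {2} (ℕ.s≤s ℕ.z≤n))) (≤-refl {0ℤ})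
  0≤s : 0ℤ ≤ + s
  0≤s = +≤+ ℕ.z≤n
  0≤6s+7 : 0ℤ ≤ + 6 * + s + + 7
  0≤6s+7 = +-mono-≤ (0≤* {+ 6} {+ s} (+≤+ ℕ.z≤n) 0≤s) (+≤+ {0} {7} ℕ.z≤n)
  -- This is (6s + 7)(s² + 1) + 2s - (s + 1)²(s + 4) = 5s³ + s² - s + 3, the margin left at Δ = s² +
  -- 1, written with visibly nonnegative terms.
  0≤rest : 0ℤ ≤ + 5 * (+ s * (+ s * + s)) + ((+ s - 1ℤ) * (+ s - 1ℤ) + + s + + 2)
  0≤rest = +-mono-≤ (0≤* {+ 5} (+≤+ ℕ.z≤n) (0≤* 0≤s (0≤* 0≤s 0≤s)))
    (+-mono-≤ (+-mono-≤ (0≤a² (+ s - 1ℤ)) 0≤s) (+≤+ {0} {2} ℕ.z≤n))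
  ring₁ : ∀ d s n → + 7 * d - n + s * (+ 6 * d + + 2 - 0ℤ) ≡
    (+ 6 * s + + 7) * (d - (1ℤ + s * s)) + (+ 5 * (s * (s * s)) + ((s - 1ℤ) * (s - 1ℤ) + s + + 2)) +
    ((s + 1ℤ) * (s + 1ℤ) * (s + + 4) - n)
  ring₁ = solve-∀

module _ (ε k : ℤ) where

  open Form ε k

  P⇒discriminant : ∀ α → P α → Δ * (proj₂ α * proj₂ α) < Tr α * Tr α
  P⇒discriminant α (0<N , _) = <-by (0<* {+ 4} (+<+ (ℕ.s≤s ℕ.z≤n)) 0<N) (discriminant α)

  discriminant⇒P : ∀ α → 0ℤ < Tr α → Δ * (proj₂ α * proj₂ α) < Tr α * Tr α → P α
  discriminant⇒P α 0<Tr lt = 0<a*b⇒0<a {b = + 4} (+≤+ ℕ.z≤n) (subst (0ℤ <_)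
    (trans (cong (_- Δ * (proj₂ α * proj₂ α)) (discriminant α)) (ring (Δ * (proj₂ α * proj₂ α)) (N α)))
    (0<b-a lt)) , 0<Tr
    where
    ring : ∀ d n → d + + 4 * n - d ≡ n * + 4
    ring = solve-∀

  -- With 2α = a + b√D, a is the trace, and Δy² = Db² since both are (α - α′)². This form covers b =
  -- y and b = 2y.
  TwiceCoordinates : ℕ → OK → Set
  TwiceCoordinates D α = ∃₂ λ a b → twice D α ≡ (a , b) × Tr α ≡ a × Δ * (proj₂ α * proj₂ α) ≡ + D * (b * b)

  TotPos⇒P : ∀ D α → TwiceCoordinates D α → TotPos D α → P α
  TotPos⇒P D α (a , b , eq , Tr≡ , Δy²≡) tp =
    let 0<a , Db²<a² = PosConj⇒ {D} a b (subst (PosConj D) eq tp)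
    in discriminant⇒P α (subst (0ℤ <_) (sym Tr≡) 0<a) (subst₂ _<_ (sym Δy²≡) (sym (cong₂ _*_ Tr≡ Tr≡)) Db²<a²)

  P⇒TotPos : ∀ D α → TwiceCoordinates D α → P α → TotPos D α
  P⇒TotPos D α (a , b , eq , Tr≡ , Δy²≡) pα = subst (PosConj D) (sym eq) (⇒PosConj {D} a b
    (subst (0ℤ <_) Tr≡ (0<Tr pα)) (subst₂ _<_ Δy²≡ (cong₂ _*_ Tr≡ Tr≡) (P⇒discriminant α pα)))

  norm-below-bound : ∀ {D} → 2 ℕ.≤ D → SquareFree D → Δ ≡ + disc D →
    (∀ α → TwiceCoordinates D α) →
    (∀ α → normK D α ≡ N α) →
    ∀ α → UniquelyDecomposable D α → normK D α <ₛ (disc D , bound (disc D))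
  norm-below-bound {D} 2≤D sf Δ≡ twice≡ normK≡ α (_ , l , (all , sum≡α) , unique) =
    let s , s²≤disc , disc<[s+1]² = sqrt-floor (disc D)
        s²<disc = ℕ.≤∧≢⇒< s²≤disc (disc-nonsquare 2≤D sf s)
    in below-bound {disc D} {s} (normK D α) s²<disc
      (subst (_≤ (+ s + 1ℤ) * (+ s + 1ℤ) * (+ s + + 4)) (sym (normK≡ α)) (N≤ s s²<disc disc<[s+1]²))
    where
    N≤ : ∀ s → s ℕ.* s ℕ.< disc D → disc D ℕ.< ℕ.suc s ℕ.* ℕ.suc s → N α ≤ (+ s + 1ℤ) * (+ s + 1ℤ) * (+ s + + 4)
    N≤ s s²<disc disc<[s+1]² = subst (λ σ → N σ ≤ (+ s + 1ℤ) * (+ s + 1ℤ) * (+ s + + 4)) sum≡α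
      (N-bound l (all , λ m all-m sum≡ → unique m (all-m , trans sum≡ sum≡α)))
      where
      +s²<Δ : + s * + s < Δ
      +s²<Δ = subst₂ _<_ (pos-* s s) (sym Δ≡) (+<+ s²<disc)
      Δ<[+s+1]² : Δ < (+ s + 1ℤ) * (+ s + 1ℤ)
      Δ<[+s+1]² = subst₂ _<_ (sym Δ≡)
        (trans (pos-* (ℕ.suc s) (ℕ.suc s)) (cong₂ _*_ (+-comm 1ℤ (+ s)) (+-comm 1ℤ (+ s)))) (+<+ disc<[s+1]²)
      open UniqueDecomposition D ε k
        (λ α → TotPos⇒P D α (twice≡ α)) (λ α → P⇒TotPos D α (twice≡ α)) (+ s) (+≤+ ℕ.z≤n) +s²<Δ Δ<[+s+1]²

-- The two cases of D modulo 4

module _ {D} (D≡1 : D ℕ.% 4 ≡ 1) where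

  disc-1 : disc D ≡ D
  disc-1 with D≡1mod4? D
  ... | yes _  = refl
  ... | no D≢1 = contradiction D≡1 D≢1

  twice-1 : ∀ x y → twice D (x , y) ≡ (+ 2 * x + y , y)
  twice-1 x y with D≡1mod4? D
  ... | yes _  = refl
  ... | no D≢1 = contradiction D≡1 D≢1

  normK-1 : ∀ x y → normK D (x , y) ≡ x * x + x * y - + (D ℕ./ 4) * (y * y)
  normK-1 x y with D≡1mod4? D
  ... | yes _  = refl
  ... | no D≢1 = contradiction D≡1 D≢1

  norm-below-bound-1 : 2 ℕ.≤ D → SquareFree D → ∀ α → UniquelyDecomposable D α →
    normK D α <ₛ (disc D , bound (disc D))
  norm-below-bound-1 2≤D sf = norm-below-bound 1ℤ k {D} 2≤D sf (trans Δ≡D (cong +_ (sym disc-1)))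
    (λ (x , y) → + 2 * x + y , y , twice-1 x y ,
      trans (Tr-≡ x y) (cong (λ z → + 2 * x + z) (*-identityˡ y)) , cong (_* (y * y)) Δ≡D)
    (λ (x , y) → trans (normK-1 x y)
      (sym (trans (N-≡ x y) (cong (λ z → x * x + z - k * (y * y)) (*-identityˡ (x * y))))))
    where
    k : ℤ
    -- As the remainder is 1, this is (D - 1)/4, and ω = (1 + √D)/2 satisfies ω² = ω + k.
    k = + (D ℕ./ 4)
    open Form 1ℤ k
    Δ≡D : Δ ≡ + D
    Δ≡D = begin
      1ℤ + + 4 * k                        ≡⟨ cong (λ t → 1ℤ + t) (*-comm (+ 4) k) ⟩
      1ℤ + k * + 4                        ≡⟨ cong (λ t → 1ℤ + t) (pos-* (D ℕ./ 4) 4) ⟨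
      + (1 ℕ.+ D ℕ./ 4 ℕ.* 4)             ≡⟨ cong (λ r → + (r ℕ.+ D ℕ./ 4 ℕ.* 4)) D≡1 ⟨
      + (D ℕ.% 4 ℕ.+ D ℕ./ 4 ℕ.* 4)       ≡⟨ cong +_ (m≡m%n+[m/n]*n D 4) ⟨
      + D                                 ∎
      where open ≡-Reasoning

module _ {D} (D≢1 : D ℕ.% 4 ≢ 1) where

  disc-≢1 : disc D ≡ 4 ℕ.* D
  disc-≢1 with D≡1mod4? D
  ... | yes D≡1 = contradiction D≡1 D≢1
  ... | no _    = refl

  twice-≢1 : ∀ x y → twice D (x , y) ≡ (+ 2 * x , + 2 * y)
  twice-≢1 x y with D≡1mod4? D
  ... | yes D≡1 = contradiction D≡1 D≢1
  ... | no _    = refl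

  normK-≢1 : ∀ x y → normK D (x , y) ≡ x * x - + D * (y * y)
  normK-≢1 x y with D≡1mod4? D
  ... | yes D≡1 = contradiction D≡1 D≢1
  ... | no _    = refl

  norm-below-bound-≢1 : 2 ℕ.≤ D → SquareFree D → ∀ α → UniquelyDecomposable D α →
    normK D α <ₛ (disc D , bound (disc D))
  norm-below-bound-≢1 2≤D sf = norm-below-bound 0ℤ (+ D) {D} 2≤D sf
    (trans (+-identityˡ (+ 4 * + D)) (trans (sym (pos-* 4 D)) (cong +_ (sym disc-≢1))))
    (λ (x , y) → + 2 * x , + 2 * y , twice-≢1 x y , trans (Tr-≡ x y) (ring₁ x y) , ring₂ (+ D) y)
    (λ (x , y) → trans (normK-≢1 x y) (trans (ring₃ (+ D) x y) (sym (N-≡ x y))))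
    where
    open Form 0ℤ (+ D)
    ring₁ : ∀ x y → + 2 * x + 0ℤ * y ≡ + 2 * x
    ring₁ = solve-∀
    ring₂ : ∀ d y → (0ℤ * 0ℤ + + 4 * d) * (y * y) ≡ d * (+ 2 * y * (+ 2 * y))
    ring₂ = solve-∀
    ring₃ : ∀ d x y → x * x - d * (y * y) ≡ x * x + 0ℤ * (x * y) - d * (y * y)
    ring₃ = solve-∀

theorem5p4 : (D : ℕ) → 2 ℕ.≤ D → SquareFree D → (α : OK) →
    UniquelyDecomposable D α → normK D α <ₛ (disc D , bound (disc D))
theorem5p4 D 2≤D sf α ud = [ (λ D≡1 → norm-below-bound-1 {D} D≡1 2≤D sf α ud) , (λ D≢1 → norm-below-bound-≢1 {D} D≢1 2≤D sf α ud) ]′ (toSum (D≡1mod4? D))
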